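{- (i) For every odd $k$, the optimal deterministic competitive ratio for One-out-of-$m$ Paging with $k$ slots and $m=(k+1)/2$ is at least $\binom{k}{m}=\Omega(2^k/\sqrt{k})$. For every $k$, the optimal deterministic competitive ratio for One-out-of-$m$ Paging with $k$ slots and $m=\lfloor (k+1)/2\rfloor$ is $\Omega(2^k/\sqrt{k})$. (ii) For every even $m\ge 2$ and every $k>m$ that is an odd multiple of $m-1$, the optimal deterministic competitive ratio for One-out-of-$m$ Paging with $k$ slots is at least $\binom{m-1}{m/2}\left(\frac{k}{m-1}\right)^{m/2}=\Theta\big((4k/m)^{m/2}/\sqrt{m}\big)=\Omega\big(\sqrt{|\mathcal{F}|}\big)$, where $\mathcal{F}=\binom{[k]}{m}$.
   Context: Slot-Heterogenous Paging: cache slots $[k]$, a family $\mathcal{F}\subseteq 2^{[k]}\setminus\{\emptyset\}$ of requestable slot sets, and requests $(p,S)$ with $p$ a page and $S\in\mathcal{F}$. A configuration assigns to each slot a single page or nothing and satisfies $(p,S)$ if some slot in $S$ holds $p$. A solution is a sequence of configurations $C_1,\dots,C_T$ with $C_t$ satisfying the $t$-th request; its cost is the number of retrievals (page $p$ is retrieved in slot $s$ at time $t$ if $C_t$ assigns $p$ to $s$ but $C_{t-1}$ does not, or $t=1$). A deterministic online algorithm is $c$-competitive if its cost is at most $c\cdot\mathrm{OPT}(\sigma)+b$ for every request sequence $\sigma$, for a constant $b$ independent of $\sigma$; the optimal deterministic competitive ratio is the infimum of such $c$ over deterministic online algorithms. One-out-of-$m$ Paging is Slot-Heterogenous Paging with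 $\mathcal{F}=\binom{[k]}{m}=\{S\subseteq[k]: |S|=m\}$. -}

module Defs where

open import Data.Nat as ℕ using (ℕ; zero; suc; _∸_; _≡ᵇ_)
open import Data.Integer using (+_)
open import Data.Rational as ℚ using (ℚ; 0ℚ; 1ℚ; _/_)
open import Data.Fin using (Fin)
open import Data.Fin.Subset using (Subset; _∈_; ∣_∣)
open import Data.Maybe using (Maybe; just; nothing)
open import Data.Maybe.Properties using (≡-dec)
open import Data.List using (List; []; _∷_; _++_; [_]; map; allFin)
open import Data.Nat.ListAction using (sum)
open import Data.List.Relation.Binary.Pointwise using (Pointwise)
open import Data.Product using (Σ; ∃; ∃-syntax; _×_; _,_)
open import Relation.Nullary using (¬_; yes; no)
open import Relation.Binary.PropositionalEquality using (_≡_)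

Odd : ℕ → Set
Odd n = ∃[ j ] n ≡ suc (2 ℕ.* j)

Even : ℕ → Set
Even n = ∃[ j ] n ≡ 2 ℕ.* j

ℕ→ℚ : ℕ → ℚ
ℕ→ℚ n = + n / 1

-- quotient of naturals as a rational (the second argument is ≥ 1
-- wherever it is used; dividing by 0 returns 0 as junk)
_÷ℕ_ : ℕ → ℕ → ℚ
n ÷ℕ zero  = 0ℚ
n ÷ℕ suc d = + n / suc d

_^ℚ_ : ℚ → ℕ → ℚ
q ^ℚ zero  = 1ℚ
q ^ℚ suc n = q ℚ.* (q ^ℚ n)

-- Slot-Heterogenous Paging with k slots (Fin k) and a family F of
-- requestable slot sets, given as a predicate on subsets of [k].
-- Pages are natural numbers.

Config : ℕ → Set
Config k = Fin k → Maybe ℕ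

Request : (k : ℕ) → (Subset k → Set) → Set
Request k F = ℕ × Σ (Subset k) F

Satisfies : ∀ {k F} → Config k → Request k F → Set
Satisfies {k} C (p , S , _) = ∃[ s ] (s ∈ S × C s ≡ just p)

IsSolution : ∀ {k F} → List (Request k F) → List (Config k) → Set
IsSolution σ sol = Pointwise (λ r C → Satisfies C r) σ sol

retrieved : ∀ {k} → Config k → Config k → Fin k → ℕ
retrieved prev cur s with cur s
... | nothing = 0
... | just p with ≡-dec ℕ._≟_ (prev s) (just p)
...   | yes _ = 0
...   | no  _ = 1

stepCost : ∀ {k} → Config k → Config k → ℕ
stepCost {k} prev cur = sum (map (retrieved prev cur) (allFin k))

emptyConfig : ∀ {k} → Config k
emptyConfig _ = nothing

-- cost of a sequence of configurations; at time 1 every assigned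
-- page counts as retrieved (comparison with the empty configuration)
costFrom : ∀ {k} → Config k → List (Config k) → ℕ
costFrom prev []         = 0
costFrom prev (C ∷ Cs)   = stepCost prev C ℕ.+ costFrom C Cs

cost : ∀ {k} → List (Config k) → ℕ
cost = costFrom emptyConfig

record OnlineAlg (k : ℕ) (F : Subset k → Set) : Set where
  field
    step  : List (Request k F) → Request k F → Config k
    valid : ∀ hist r → Satisfies (step hist r) r

open OnlineAlg public

runFrom : ∀ {k F} → OnlineAlg k F → List (Request k F) → List (Request k F) → List (Config k)
runFrom A hist []       = []
runFrom A hist (r ∷ rs) = step A hist r ∷ runFrom A (hist ++ [ r ]) rs

run : ∀ {k F} → OnlineAlg k F → List (Request k F) → List (Config k)
run A σ = runFrom A [] σ

-- A is c-competitive: ∃ constant b, ∀ σ, cost(A(σ)) ≤ c·OPT(σ) + b.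
-- OPT(σ) is the minimum cost over solutions for σ; quantifying over all
-- solutions sol of σ and comparing with cost(sol) is the literal
-- unfolding of "≤ c·OPT(σ) + b" (the minimum is attained).
IsCompetitive : ∀ {k F} → OnlineAlg k F → ℚ → Set
IsCompetitive {k} {F} A c =
  ∃[ b ] ∀ (σ : List (Request k F)) (sol : List (Config k)) → IsSolution σ sol →
    ℕ→ℚ (cost (run A σ)) ℚ.≤ c ℚ.* ℕ→ℚ (cost sol) ℚ.+ b

CompetitiveRatioAchievable : (k : ℕ) → (Subset k → Set) → ℚ → Set
CompetitiveRatioAchievable k F c = ∃[ A ] IsCompetitive {k} {F} A c

-- "the optimal deterministic competitive ratio is at least L":
-- L is a lower bound on every achievable ratio, i.e. L ≤ the infimum.
OptRatioAtLeast : (k : ℕ) → (Subset k → Set) → ℚ → Set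
OptRatioAtLeast k F L = ∀ c → CompetitiveRatioAchievable k F c → L ℚ.≤ c

OneOutOf : (k m : ℕ) → Subset k → Set
OneOutOf k m S = ∣ S ∣ ≡ m

{-# OPTIONS --safe #-}
module Submission where

-- Split the slots into 2n + 1 groups, with requests touching n + 1 of them, and use only two pages.  Each group
-- has J pairs of configurations, one of either colour, that differ in a single slot; every cache content leaves
-- in each group some block of slots missing one of the pages, so by majority some request with n + 1 such blocks
-- is unserved and the algorithm pays at least 1 per step.  Consider the states with n + 1 groups of colour true.
-- Pair each of them with a state with n groups of colour true that differs in one group, by the bracket matching
-- of the two middle levels of the Boolean lattice.  One offline solution per pair moves back and forth inside its
-- pair, at cost 1 per move.  A request is missed by J^n states at most, so at most J^n of the C(2n+1, n+1) J^(2n+1)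
-- solutions have to move, and their average cost grows C(2n+1, n+1) J^(n+1) times slower than that of the algorithm.
-- For part (i) a group is one slot.  For part (ii) it is an odd cycle of J slots and the blocks are its edges:
-- a 2-colouring of an odd cycle has a monochromatic edge, and it can be made to have only one.

open import Defs
open import Data.Bool as Bool using (Bool; true; false; not; _xor_)
open import Data.Bool.Properties using (not-involutive; xor-identityʳ; ¬-not; not-¬)
open import Data.Nat as ℕ using (ℕ; zero; suc; pred; _∸_; _≥_; _<_; _≤_; z≤n; s≤s; s≤s⁻¹; _≤?_; _+_; _*_; _^_; _!; NonZero)
open import Data.Nat.Properties
open import Data.Nat.DivMod using (_/_; m*n/n≡m; +-distrib-/-∣ʳ)
open import Data.Nat.Divisibility using (n∣m*n)
open import Data.Nat.Combinatorics using (_C_; nCk+nC[k+1]≡[n+1]C[k+1]; nCk≡nC[n∸k]; k>n⇒nCk≡0; nC1≡n)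
open import Data.Nat.ListAction using (sum)
open import Data.Nat.ListAction.Properties using (sum-++)
open import Data.Nat.Tactic.RingSolver using (solve-∀)
import Data.Nat.Coprimality as Coprimality
open import Data.Integer as ℤ using (-[1+_]; +<+; -<+; +≤+)
import Data.Integer.Properties as ℤₚ
open import Data.Rational as ℚ using (ℚ; 0ℚ; 1ℚ; mkℚ; *<*; *≤*)
import Data.Rational.Properties as ℚₚ
import Data.Rational.Unnormalised as ℚᵘ
import Data.Rational.Unnormalised.Properties as ℚᵘₚ
open import Data.Rational.Solver using (module +-*-Solver)
open import Data.Fin using (Fin; zero; suc; toℕ; fromℕ; inject₁; _↑ˡ_; _↑ʳ_; splitAt)
open import Data.Fin.Properties using (splitAt-↑ˡ; splitAt-↑ʳ; toℕ-inject₁; toℕ-fromℕ)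
open import Data.Fin.Relation.Unary.Top using (view; ‵fromℕ; ‵inject₁; view-fromℕ; view-inject₁)
open import Data.Fin.Subset using (Subset; _∈_; ∣_∣; ⊥; ⁅_⁆; _∪_; outside)
open import Data.Fin.Subset.Properties using (∣⊥∣≡0; ∉⊥; ∣⁅x⁆∣≡1; ∪-identityˡ; ∪-identityʳ; x∈⁅x⁆; x∈⁅y⁆⇒x≡y; x∈p∪q⁺; x∈p∪q⁻)
open import Data.Vec as Vec using (Vec; []; _∷_; here; there)
open import Data.Maybe using (Maybe; just; nothing)
import Data.Maybe.Properties as Maybeₚ
open import Data.List using (List; []; _∷_; _++_; [_]; map; tabulate; cartesianProductWith; allFin; length)
open import Data.List.Properties using (map-++; map-∘; map-tabulate; tabulate-cong; length-tabulate)
open import Data.List.Relation.Binary.Pointwise using ([]; _∷_)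
open import Data.Product using (∃-syntax; _×_; _,_; proj₁; proj₂)
open import Data.Sum as Sum using (_⊎_; inj₁; inj₂; [_,_]′)
open import Relation.Nullary using (¬_; yes; no; contradiction)
open import Relation.Binary.PropositionalEquality using (_≡_; _≢_; refl; sym; trans; cong; cong₂; subst; subst₂; module ≡-Reasoning)

-- Binomial estimates

-- The absorption identity, by induction from Pascal's rule.
[1+k]*[1+n]C[1+k]≡[1+n]*nCk : ∀ n k → suc k * (suc n C suc k) ≡ suc n * (n C k)
[1+k]*[1+n]C[1+k]≡[1+n]*nCk zero zero = refl
[1+k]*[1+n]C[1+k]≡[1+n]*nCk zero (suc k) =
  trans (cong (suc (suc k) *_) (k>n⇒nCk≡0 {1} {suc (suc k)} (s≤s (s≤s z≤n)))) (*-zeroʳ (suc (suc k)))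
[1+k]*[1+n]C[1+k]≡[1+n]*nCk (suc n) zero =
  trans (*-identityˡ _) (trans (nC1≡n (suc (suc n))) (sym (*-identityʳ _)))
[1+k]*[1+n]C[1+k]≡[1+n]*nCk (suc n) (suc k) = begin-equality
  suc (suc k) * (suc (suc n) C suc (suc k))
    ≡⟨ cong (suc (suc k) *_) (nCk+nC[k+1]≡[n+1]C[k+1] (suc n) (suc k)) ⟨
  suc (suc k) * (A + B)
    ≡⟨ expand k A B ⟩
  A + suc k * A + suc (suc k) * B
    ≡⟨ cong₂ (λ u v → A + u + v) ([1+k]*[1+n]C[1+k]≡[1+n]*nCk n k) ([1+k]*[1+n]C[1+k]≡[1+n]*nCk n (suc k)) ⟩
  A + suc n * (n C k) + suc n * (n C suc k)
    ≡⟨ collect n A (n C k) (n C suc k) ⟩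
  A + suc n * ((n C k) + (n C suc k))
    ≡⟨ cong (λ u → A + suc n * u) (nCk+nC[k+1]≡[n+1]C[k+1] n k) ⟩
  suc (suc n) * A ∎
  where
  open ≤-Reasoning
  A = suc n C suc k
  B = suc n C suc (suc k)
  expand : ∀ k a b → suc (suc k) * (a + b) ≡ a + suc k * a + suc (suc k) * b
  expand = solve-∀
  collect : ∀ n a x y → a + suc n * x + suc n * y ≡ a + suc n * (x + y)
  collect = solve-∀

nCk*k!≤n^k : ∀ n k → (n C k) * k ! ≤ n ^ k
nCk*k!≤n^k n zero = ≤-refl
nCk*k!≤n^k zero (suc k) = ≤-reflexive (cong (_* (suc k !)) (k>n⇒nCk≡0 {0} {suc k} (s≤s z≤n)))
nCk*k!≤n^k (suc n) (suc k) = begin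
  (suc n C suc k) * (suc k * k !)  ≡⟨ rearrange (suc n C suc k) (suc k) (k !) ⟩
  suc k * (suc n C suc k) * k !    ≡⟨ cong (_* k !) ([1+k]*[1+n]C[1+k]≡[1+n]*nCk n k) ⟩
  suc n * (n C k) * k !            ≡⟨ *-assoc (suc n) (n C k) (k !) ⟩
  suc n * ((n C k) * k !)          ≤⟨ *-monoʳ-≤ (suc n) (nCk*k!≤n^k n k) ⟩
  suc n * n ^ k                    ≤⟨ *-monoʳ-≤ (suc n) (^-monoˡ-≤ k (n≤1+n n)) ⟩
  suc n ^ suc k                    ∎
  where
  open ≤-Reasoning
  rearrange : ∀ a b c → a * (b * c) ≡ b * a * c
  rearrange = solve-∀

midBinom : ℕ → ℕ
midBinom n = suc (2 * n) C suc n

-- Absorption reduces row 2n+3 to the centre of row 2n+2, and Pascal's rule splits that into the two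
-- middle entries of row 2n+1, which are equal.
midBinom-suc : ∀ n → (n + 2) * midBinom (suc n) ≡ 2 * (2 * n + 3) * midBinom n
midBinom-suc n = begin-equality
  (n + 2) * midBinom (suc n)
    ≡⟨ cong₂ (λ u v → u * (suc v C suc (suc n))) (+-comm n 2) (cong suc (+-suc n (n + 0))) ⟩
  suc (suc n) * (suc (suc (suc (2 * n))) C suc (suc n))
    ≡⟨ [1+k]*[1+n]C[1+k]≡[1+n]*nCk (suc (suc (2 * n))) (suc n) ⟩
  suc (suc (suc (2 * n))) * (suc (suc (2 * n)) C suc n)
    ≡⟨ cong (suc (suc (suc (2 * n))) *_) (nCk+nC[k+1]≡[n+1]C[k+1] (suc (2 * n)) n) ⟨
  suc (suc (suc (2 * n))) * ((suc (2 * n) C n) + midBinom n)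
    ≡⟨ cong (λ u → suc (suc (suc (2 * n))) * (u + midBinom n)) symmetric ⟩
  suc (suc (suc (2 * n))) * (midBinom n + midBinom n)
    ≡⟨ collect n (midBinom n) ⟩
  2 * (2 * n + 3) * midBinom n ∎
  where
  open ≤-Reasoning
  1+2n≡n+1+n : suc (2 * n) ≡ suc n + n
  1+2n≡n+1+n = cong suc (cong (n +_) (+-identityʳ n))
  symmetric : suc (2 * n) C n ≡ midBinom n
  symmetric = trans (nCk≡nC[n∸k] (≤-trans (m≤m+n n (n + 0)) (n≤1+n _)))
    (cong (suc (2 * n) C_) (trans (cong (ℕ._∸ n) 1+2n≡n+1+n) (m+n∸n≡m (suc n) n)))
  collect : ∀ n c → suc (suc (suc (2 * n))) * (c + c) ≡ 2 * (2 * n + 3) * c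
  collect = solve-∀

-- Squaring avoids the root in 4^n / √(n+1). By the ratio `midBinom-suc` the induction step is
-- 16(n+1)(n+2) ≤ 4(2n+3)², where the difference is 4.
midBinom-lower : ∀ n → 16 ^ n ≤ midBinom n * midBinom n * suc n
midBinom-lower zero = ≤-refl
midBinom-lower (suc n) = *-cancelʳ-≤ _ _ (suc (suc n)) (begin
  16 ^ suc n * suc (suc n)
    ≤⟨ *-monoˡ-≤ (suc (suc n)) (*-monoʳ-≤ 16 (midBinom-lower n)) ⟩
  16 * (c * c * suc n) * suc (suc n)
    ≤⟨ m≤m+n _ (4 * (c * c)) ⟩
  16 * (c * c * suc n) * suc (suc n) + 4 * (c * c)
    ≡⟨ square n c ⟩
  (2 * (2 * n + 3) * c) * (2 * (2 * n + 3) * c)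
    ≡⟨ cong (λ u → u * u) (midBinom-suc n) ⟨
  ((n + 2) * c′) * ((n + 2) * c′)
    ≡⟨ regroup n c′ ⟩
  c′ * c′ * suc (suc n) * suc (suc n) ∎)
  where
  open ≤-Reasoning
  c = midBinom n
  c′ = midBinom (suc n)
  square : ∀ n c → 16 * (c * c * suc n) * suc (suc n) + 4 * (c * c)
         ≡ (2 * (2 * n + 3) * c) * (2 * (2 * n + 3) * c)
  square = solve-∀
  regroup : ∀ n c → ((n + 2) * c) * ((n + 2) * c) ≡ c * c * suc (suc n) * suc (suc n)
  regroup = solve-∀

-- The induction step is 4(2n+3)(2n+5) ≤ 16(n+2)², again with difference 4. The factor 2n+3 makes
-- the two sides nearly equal.
midBinom-upper : ∀ n → midBinom n * midBinom n * (2 * n + 3) ≤ 4 * 16 ^ n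
midBinom-upper zero = s≤s (s≤s (s≤s z≤n))
midBinom-upper (suc n) = *-cancelʳ-≤ _ _ ((n + 2) * (n + 2)) {{sq≢0}} (begin
  c′ * c′ * (2 * suc n + 3) * ((n + 2) * (n + 2))
    ≡⟨ regroup n c′ ⟩
  ((n + 2) * c′) * ((n + 2) * c′) * (2 * n + 5)
    ≡⟨ cong (λ u → u * u * (2 * n + 5)) (midBinom-suc n) ⟩
  (2 * (2 * n + 3) * c) * (2 * (2 * n + 3) * c) * (2 * n + 5)
    ≡⟨ regroup′ n c ⟩
  c * c * (2 * n + 3) * (4 * (2 * n + 3) * (2 * n + 5))
    ≤⟨ *-mono-≤ (midBinom-upper n) (≤-trans (m≤m+n _ 4) (≤-reflexive (complete n))) ⟩
  4 * 16 ^ n * (16 * ((n + 2) * (n + 2)))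
    ≡⟨ regroup″ (16 ^ n) ((n + 2) * (n + 2)) ⟩
  4 * 16 ^ suc n * ((n + 2) * (n + 2)) ∎)
  where
  open ≤-Reasoning
  c = midBinom n
  c′ = midBinom (suc n)
  sq≢0 : NonZero ((n + 2) * (n + 2))
  sq≢0 = subst (λ u → NonZero (u * u)) (+-comm 2 n) _
  regroup : ∀ n c → c * c * (2 * suc n + 3) * ((n + 2) * (n + 2))
          ≡ ((n + 2) * c) * ((n + 2) * c) * (2 * n + 5)
  regroup = solve-∀
  regroup′ : ∀ n c → (2 * (2 * n + 3) * c) * (2 * (2 * n + 3) * c) * (2 * n + 5)
           ≡ c * c * (2 * n + 3) * (4 * (2 * n + 3) * (2 * n + 5))
  regroup′ = solve-∀
  complete : ∀ n → 4 * (2 * n + 3) * (2 * n + 5) + 4 ≡ 16 * ((n + 2) * (n + 2))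
  complete = solve-∀
  regroup″ : ∀ x y → 4 * x * (16 * y) ≡ 4 * (16 * x) * y
  regroup″ = solve-∀

^-distribʳ-* : ∀ a b n → (a * b) ^ n ≡ a ^ n * b ^ n
^-distribʳ-* a b zero = refl
^-distribʳ-* a b (suc n) = trans (cong (a * b *_) (^-distribʳ-* a b n)) (regroup a b (a ^ n) (b ^ n))
  where
  regroup : ∀ a b x y → a * b * (x * y) ≡ a * x * (b * y)
  regroup = solve-∀

-- The first two terms of the binomial expansion: Bernoulli's inequality for (1 + 1/a)^(n+1) with
-- denominators cleared.
bernoulli : ∀ a n → a ^ suc n + suc n * a ^ n ≤ suc a ^ suc n
bernoulli a zero = ≤-reflexive (simplify a)
  where
  simplify : ∀ a → a * 1 + 1 * 1 ≡ suc a * 1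
  simplify = solve-∀
bernoulli a (suc n) = begin
  a * (a * a ^ n) + suc (suc n) * (a * a ^ n)      ≤⟨ m≤m+n _ (suc n * a ^ n) ⟩
  a * (a * a ^ n) + suc (suc n) * (a * a ^ n) + suc n * a ^ n ≡⟨ regroup a n (a ^ n) ⟩
  suc a * (a ^ suc n + suc n * a ^ n)              ≤⟨ *-monoʳ-≤ (suc a) (bernoulli a n) ⟩
  suc a ^ suc (suc n)                              ∎
  where
  open ≤-Reasoning
  regroup : ∀ a n x → a * (a * x) + suc (suc n) * (a * x) + suc n * x ≡ suc a * (a * x + suc n * x)
  regroup = solve-∀

-- (1 - 1/m)^m increases with m: with a = m (m + 2) this is Bernoulli's inequality for (a + 1)^(m+1) = (m+1)^(2(m+1)).
[1-1/m]^m-increasing : ∀ m → (2 + m) ^ (2 + m) * m ^ (1 + m) ≤ (1 + m) ^ (2 + m) * (1 + m) ^ (1 + m)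
[1-1/m]^m-increasing m = begin
  (2 + m) ^ (2 + m) * m ^ (1 + m)
    ≡⟨ *-assoc (2 + m) ((2 + m) ^ (1 + m)) (m ^ (1 + m)) ⟩
  (2 + m) * ((2 + m) ^ (1 + m) * m ^ (1 + m))
    ≡⟨ cong ((2 + m) *_) (trans (*-comm _ (m ^ (1 + m))) (sym (^-distribʳ-* m (2 + m) (1 + m)))) ⟩
  (2 + m) * (a * a ^ m)
    ≤⟨ m≤m+n _ (a ^ m) ⟩
  (2 + m) * (a * a ^ m) + a ^ m
    ≡⟨ regroup m (a ^ m) ⟩
  (1 + m) * (a ^ (1 + m) + (1 + m) * a ^ m)
    ≤⟨ *-monoʳ-≤ (1 + m) (bernoulli a m) ⟩
  (1 + m) * suc a ^ (1 + m)
    ≡⟨ cong (λ u → (1 + m) * u ^ (1 + m)) (square m) ⟩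
  (1 + m) * ((1 + m) * (1 + m)) ^ (1 + m)
    ≡⟨ cong ((1 + m) *_) (^-distribʳ-* (1 + m) (1 + m) (1 + m)) ⟩
  (1 + m) * ((1 + m) ^ (1 + m) * (1 + m) ^ (1 + m))
    ≡⟨ *-assoc (1 + m) ((1 + m) ^ (1 + m)) ((1 + m) ^ (1 + m)) ⟨
  (1 + m) ^ (2 + m) * (1 + m) ^ (1 + m) ∎
  where
  open ≤-Reasoning
  a = m * (2 + m)
  regroup : ∀ m x → (2 + m) * (m * (2 + m) * x) + x ≡ (1 + m) * (m * (2 + m) * x + (1 + m) * x)
  regroup = solve-∀
  square : ∀ m → suc (m * (2 + m)) ≡ (1 + m) * (1 + m)
  square = solve-∀

-- The sequence (1 - 1/m)^m is increasing and equals 1/4 at m = 2, so the constant 4 is attained in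
-- the base case.
[1+m]^[1+m]≤4*m^[1+m] : ∀ m .{{_ : NonZero m}} → suc m ^ suc m ≤ 4 * m ^ suc m
[1+m]^[1+m]≤4*m^[1+m] (suc zero) = ≤-refl
[1+m]^[1+m]≤4*m^[1+m] (suc m@(suc _)) = *-cancelʳ-≤ _ _ (m ^ suc m) {{m^n≢0 m (suc m)}} (begin
  (2 + m) ^ (2 + m) * m ^ (1 + m)            ≤⟨ [1-1/m]^m-increasing m ⟩
  (1 + m) ^ (2 + m) * (1 + m) ^ (1 + m)      ≤⟨ *-monoʳ-≤ ((1 + m) ^ (2 + m)) ([1+m]^[1+m]≤4*m^[1+m] m) ⟩
  (1 + m) ^ (2 + m) * (4 * m ^ (1 + m))      ≡⟨ regroup ((1 + m) ^ (2 + m)) (m ^ (1 + m)) ⟩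
  4 * (1 + m) ^ (2 + m) * m ^ (1 + m)        ∎)
  where
  open ≤-Reasoning
  regroup : ∀ x y → x * (4 * y) ≡ 4 * x * y
  regroup = solve-∀

-- A crude Stirling bound: passing from m to m+1 multiplies the left side by (m+1)(1 + 1/m)^(m+1),
-- which is at most 4(m+1).
m^[1+m]≤4^m*m! : ∀ m → m ^ suc m ≤ 4 ^ m * m !
m^[1+m]≤4^m*m! zero = z≤n
m^[1+m]≤4^m*m! (suc zero) = s≤s z≤n
m^[1+m]≤4^m*m! (suc m@(suc _)) = begin
  suc m * suc m ^ suc m             ≤⟨ *-monoʳ-≤ (suc m) ([1+m]^[1+m]≤4*m^[1+m] m) ⟩
  suc m * (4 * m ^ suc m)           ≤⟨ *-monoʳ-≤ (suc m) (*-monoʳ-≤ 4 (m^[1+m]≤4^m*m! m)) ⟩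
  suc m * (4 * (4 ^ m * m !))       ≡⟨ regroup (suc m) (4 ^ m) (m !) ⟩
  4 ^ suc m * (suc m * m !)         ∎
  where
  open ≤-Reasoning
  regroup : ∀ s x y → s * (4 * (x * y)) ≡ 4 * x * (s * y)
  regroup = solve-∀

-- Rational numbers

-- Exposes the normal form, so that sums, products and comparisons compute on numerators.
ℕ→ℚ≡mkℚ : ∀ n → ℕ→ℚ n ≡ mkℚ (ℤ.+ n) 0 (Coprimality.sym (Coprimality.1-coprimeTo n))
ℕ→ℚ≡mkℚ n = ℚₚ.normalize-coprime (Coprimality.sym (Coprimality.1-coprimeTo n))

ℕ→ℚ-+ : ∀ a b → ℕ→ℚ (a + b) ≡ ℕ→ℚ a ℚ.+ ℕ→ℚ b
ℕ→ℚ-+ a b rewrite ℕ→ℚ≡mkℚ a | ℕ→ℚ≡mkℚ b =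
  cong (λ i → i ℚ./ 1) (trans (ℤₚ.pos-+ a b) (sym (cong₂ ℤ._+_ (ℤₚ.*-identityʳ (ℤ.+ a)) (ℤₚ.*-identityʳ (ℤ.+ b)))))

ℕ→ℚ-* : ∀ a b → ℕ→ℚ (a * b) ≡ ℕ→ℚ a ℚ.* ℕ→ℚ b
ℕ→ℚ-* a b rewrite ℕ→ℚ≡mkℚ a | ℕ→ℚ≡mkℚ b = cong (λ i → i ℚ./ 1) (ℤₚ.pos-* a b)

ℕ→ℚ-^ : ∀ a n → ℕ→ℚ (a ^ n) ≡ ℕ→ℚ a ^ℚ n
ℕ→ℚ-^ a zero = refl
ℕ→ℚ-^ a (suc n) = trans (ℕ→ℚ-* a (a ^ n)) (cong (ℕ→ℚ a ℚ.*_) (ℕ→ℚ-^ a n))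

ℕ→ℚ-mono-≤ : ∀ {a b} → a ≤ b → ℕ→ℚ a ℚ.≤ ℕ→ℚ b
ℕ→ℚ-mono-≤ {a} {b} a≤b rewrite ℕ→ℚ≡mkℚ a | ℕ→ℚ≡mkℚ b =
  *≤* (subst₂ ℤ._≤_ (sym (ℤₚ.*-identityʳ (ℤ.+ a))) (sym (ℤₚ.*-identityʳ (ℤ.+ b))) (+≤+ a≤b))

ℕ→ℚ-nonNeg : ∀ n → ℚ.NonNegative (ℕ→ℚ n)
ℕ→ℚ-nonNeg n = ℚₚ.normalize-nonNeg n 1

ℕ→ℚ-pos : ∀ n .{{_ : NonZero n}} → ℚ.Positive (ℕ→ℚ n)
ℕ→ℚ-pos n = ℚₚ.normalize-pos n 1

÷ℕ-*-cancel : ∀ a d .{{_ : NonZero d}} → (a ÷ℕ d) ℚ.* ℕ→ℚ d ≡ ℕ→ℚ a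
÷ℕ-*-cancel a d@(suc d-1) = ℚₚ.toℚᵘ-injective (begin
  ℚ.toℚᵘ ((a ÷ℕ d) ℚ.* ℕ→ℚ d)                     ≈⟨ ℚₚ.toℚᵘ-homo-* (a ÷ℕ d) (ℕ→ℚ d) ⟩
  ℚ.toℚᵘ (a ÷ℕ d) ℚᵘ.* ℚ.toℚᵘ (ℕ→ℚ d)             ≈⟨ ℚᵘₚ.*-cong (ℚₚ.toℚᵘ-fromℚᵘ (ℚᵘ.mkℚᵘ (ℤ.+ a) d-1)) (ℚₚ.toℚᵘ-fromℚᵘ (ℚᵘ.mkℚᵘ (ℤ.+ d) 0)) ⟩
  ℚᵘ.mkℚᵘ (ℤ.+ a) d-1 ℚᵘ.* ℚᵘ.mkℚᵘ (ℤ.+ d) 0          ≈⟨ ℚᵘ.*≡* cancel ⟩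
  ℚᵘ.mkℚᵘ (ℤ.+ a) 0                                 ≈⟨ ℚₚ.toℚᵘ-fromℚᵘ (ℚᵘ.mkℚᵘ (ℤ.+ a) 0) ⟨
  ℚ.toℚᵘ (ℕ→ℚ a)                                  ∎)
  where
  open ℚᵘₚ.≃-Reasoning
  cancel : ((ℤ.+ a) ℤ.* (ℤ.+ d)) ℤ.* (ℤ.+ 1) ≡ (ℤ.+ a) ℤ.* (ℤ.+ (d * 1))
  cancel = trans (ℤₚ.*-identityʳ _) (cong (λ u → (ℤ.+ a) ℤ.* (ℤ.+ u)) (sym (*-identityʳ d)))

^ℚ-distribʳ-* : ∀ p q n → (p ℚ.* q) ^ℚ n ≡ (p ^ℚ n) ℚ.* (q ^ℚ n)
^ℚ-distribʳ-* p q zero = refl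
^ℚ-distribʳ-* p q (suc n) = trans (cong (p ℚ.* q ℚ.*_) (^ℚ-distribʳ-* p q n))
  (solve 4 (λ p q x y → p :* q :* (x :* y) := p :* x :* (q :* y)) refl p q (p ^ℚ n) (q ^ℚ n))
  where open +-*-Solver

ℕ→ℚ-unbounded : ∀ q → ∃[ n ] q ℚ.< ℕ→ℚ n
ℕ→ℚ-unbounded q@(mkℚ (ℤ.+ a) d-1 _) = suc a , subst (q ℚ.<_) (sym (ℕ→ℚ≡mkℚ (suc a)))
  (*<* (ℤₚ.≤-<-trans (ℤₚ.≤-reflexive (ℤₚ.*-identityʳ (ℤ.+ a)))
         (subst ((ℤ.+ a) ℤ.<_) (ℤₚ.pos-* (suc a) (suc d-1)) (+<+ (<-≤-trans (n<1+n a) (m≤m*n (suc a) (suc d-1)))))))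
ℕ→ℚ-unbounded q@(mkℚ (-[1+ a ]) d-1 _) = 0 , *<* (subst (ℤ._< (ℤ.+ 0)) (sym (ℤₚ.*-identityʳ (-[1+ a ]))) -<+)

archimedean : ∀ K δ → 0ℚ ℚ.< δ → ∃[ n ] K ℚ.< ℕ→ℚ n ℚ.* δ
archimedean K δ 0<δ = let n , K/δ<n = ℕ→ℚ-unbounded (K ℚ.* ℚ.1/ δ) in
  n , subst (ℚ._< ℕ→ℚ n ℚ.* δ)
    (trans (ℚₚ.*-assoc K (ℚ.1/ δ) δ) (trans (cong (K ℚ.*_) (ℚₚ.*-inverseˡ δ)) (ℚₚ.*-identityʳ K)))
    (ℚₚ.*-monoˡ-<-pos δ K/δ<n)
  where instance
    δ-pos = ℚ.positive 0<δ
    δ-nonZero = ℚₚ.pos⇒nonZero δ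

-- f plays the role of the cheapest offline cost after T requests: it grows at rate at most h / N, against 1 for the algorithm.
rate-bound : ∀ N h k (c b : ℚ) →
  (∀ T → ∃[ f ] (ℕ→ℚ T ℚ.≤ c ℚ.* ℕ→ℚ f ℚ.+ b × N * f ≤ N * k + T * h)) →
  ℕ→ℚ N ℚ.≤ c ℚ.* ℕ→ℚ h
rate-bound N h k c b bound with c ℚ.<? 0ℚ
-- For negative `c` the hypothesis would give `T ≤ b` for every `T`.
... | yes c<0 = let T , b<T = ℕ→ℚ-unbounded b
                    f , T≤ , _ = bound T
                in contradiction (ℚₚ.<-≤-trans b<T (ℚₚ.≤-trans T≤ (shrink f))) (ℚₚ.<-irrefl refl)
  where
  instance c-nonPos = ℚ.nonPositive (ℚₚ.<⇒≤ c<0)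
  shrink : ∀ f → c ℚ.* ℕ→ℚ f ℚ.+ b ℚ.≤ b
  shrink f = subst (c ℚ.* ℕ→ℚ f ℚ.+ b ℚ.≤_) (ℚₚ.+-identityˡ b) (ℚₚ.+-monoˡ-≤ b
    (ℚₚ.nonPositive⁻¹ (c ℚ.* ℕ→ℚ f) {{ℚₚ.nonPos*nonNeg⇒nonPos c (ℕ→ℚ f) {{ℕ→ℚ-nonNeg f}}}}))
... | no c≮0 with ℕ→ℚ N ℚ.≤? c ℚ.* ℕ→ℚ h
...   | yes done = done
...   | no N≰ch = let T , K<Tδ = archimedean K δ δ>0 in
                  contradiction (ℚₚ.<-≤-trans K<Tδ (slow T)) (ℚₚ.<-irrefl refl)
  where
  instance
    c-nonNeg = ℚ.nonNegative (ℚₚ.≮⇒≥ c≮0)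
    N-nonNeg = ℕ→ℚ-nonNeg N
  -- If the claim fails, the gap `δ` is positive. Eliminating `f` from the two bounds, which uses
  -- that `c` is not negative, gives `T * δ ≤ K` for every `T`, against the Archimedean property.
  δ = ℕ→ℚ N ℚ.- c ℚ.* ℕ→ℚ h
  K = c ℚ.* (ℕ→ℚ N ℚ.* ℕ→ℚ k) ℚ.+ ℕ→ℚ N ℚ.* b
  δ>0 : 0ℚ ℚ.< δ
  δ>0 = subst (ℚ._< δ) (ℚₚ.+-inverseʳ (c ℚ.* ℕ→ℚ h)) (ℚₚ.+-monoˡ-< (ℚ.- (c ℚ.* ℕ→ℚ h)) (ℚₚ.≰⇒> N≰ch))
  slow : ∀ T → ℕ→ℚ T ℚ.* δ ℚ.≤ K
  slow T with bound T
  ... | f , T≤ , Nf≤ = begin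
    t ℚ.* δ
      ≡⟨ solve 4 (λ t n c h → t :* (n :- c :* h) := n :* t :- c :* (t :* h)) refl t n c (ℕ→ℚ h) ⟩
    n ℚ.* t ℚ.- c ℚ.* (t ℚ.* ℕ→ℚ h)
      ≤⟨ ℚₚ.+-monoˡ-≤ _ (ℚₚ.*-monoˡ-≤-nonNeg n T≤) ⟩
    n ℚ.* (c ℚ.* ℕ→ℚ f ℚ.+ b) ℚ.- c ℚ.* (t ℚ.* ℕ→ℚ h)
      ≡⟨ solve 5 (λ t n c f b → n :* (c :* f :+ b) :- t := c :* (n :* f) :+ n :* b :- t) refl (c ℚ.* (t ℚ.* ℕ→ℚ h)) n c (ℕ→ℚ f) b ⟩
    c ℚ.* (n ℚ.* ℕ→ℚ f) ℚ.+ n ℚ.* b ℚ.- c ℚ.* (t ℚ.* ℕ→ℚ h)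
      ≤⟨ ℚₚ.+-monoˡ-≤ _ (ℚₚ.+-monoˡ-≤ _ (ℚₚ.*-monoˡ-≤-nonNeg c Nf≤′)) ⟩
    c ℚ.* (n ℚ.* ℕ→ℚ k ℚ.+ t ℚ.* ℕ→ℚ h) ℚ.+ n ℚ.* b ℚ.- c ℚ.* (t ℚ.* ℕ→ℚ h)
      ≡⟨ solve 4 (λ c u v w → c :* (u :+ v) :+ w :- c :* v := c :* u :+ w) refl c (n ℚ.* ℕ→ℚ k) (t ℚ.* ℕ→ℚ h) (n ℚ.* b) ⟩
    K ∎
    where
    open ℚₚ.≤-Reasoning
    open +-*-Solver
    t = ℕ→ℚ T
    n = ℕ→ℚ N
    Nf≤′ : n ℚ.* ℕ→ℚ f ℚ.≤ n ℚ.* ℕ→ℚ k ℚ.+ t ℚ.* ℕ→ℚ h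
    Nf≤′ = subst₂ ℚ._≤_ (ℕ→ℚ-* N f)
      (trans (ℕ→ℚ-+ (N * k) (T * h)) (cong₂ ℚ._+_ (ℕ→ℚ-* N k) (ℕ→ℚ-* T h)))
      (ℕ→ℚ-mono-≤ Nf≤)

-- The averaging argument

∑ : ∀ {X : Set} → List X → (X → ℕ) → ℕ
∑ xs f = sum (map f xs)

infix 8 ∑
syntax ∑ xs (λ x → e) = ∑[ x ∈ xs ] e

module _ {X : Set} where

  ∑-cong : ∀ (xs : List X) {f g : X → ℕ} → (∀ x → f x ≡ g x) → ∑ xs f ≡ ∑ xs g
  ∑-cong [] f≗g = refl
  ∑-cong (x ∷ xs) f≗g = cong₂ _+_ (f≗g x) (∑-cong xs f≗g)

  ∑-mono : ∀ (xs : List X) {f g : X → ℕ} → (∀ x → f x ≤ g x) → ∑ xs f ≤ ∑ xs g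
  ∑-mono [] f≤g = z≤n
  ∑-mono (x ∷ xs) f≤g = +-mono-≤ (f≤g x) (∑-mono xs f≤g)

  ∑-distrib-+ : ∀ (xs : List X) (f g : X → ℕ) → ∑[ x ∈ xs ] (f x + g x) ≡ ∑ xs f + ∑ xs g
  ∑-distrib-+ [] f g = refl
  ∑-distrib-+ (x ∷ xs) f g =
    trans (cong (f x + g x +_) (∑-distrib-+ xs f g)) (interchange (f x) (g x) (∑ xs f) (∑ xs g))
    where
    interchange : ∀ a b c d → a + b + (c + d) ≡ a + c + (b + d)
    interchange = solve-∀

  *-distribʳ-∑ : ∀ (xs : List X) (f : X → ℕ) c → ∑[ x ∈ xs ] (f x * c) ≡ ∑ xs f * c
  *-distribʳ-∑ [] f c = refl
  *-distribʳ-∑ (x ∷ xs) f c =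
    trans (cong (f x * c +_) (*-distribʳ-∑ xs f c)) (sym (*-distribʳ-+ c (f x) (∑ xs f)))

  -- Averaging as a search: if no index of nonzero weight is cheap, then `suc K ≤ N * f x` holds for
  -- each of them, and the weighted sum of these is the second alternative.
  light-or-heavy : ∀ (xs : List X) (w f : X → ℕ) N K →
    (∃[ x ] (w x ≢ 0 × N * f x ≤ K)) ⊎ (∑ xs w * suc K ≤ N * ∑[ x ∈ xs ] (w x * f x))
  light-or-heavy [] w f N K = inj₂ z≤n
  light-or-heavy (x ∷ xs) w f N K with light-or-heavy xs w f N K
  ... | inj₁ found = inj₁ found
  ... | inj₂ heavy with w x in w≡ | N * f x ≤? K
  ...   | zero  | _        = inj₂ heavy
  ...   | suc u | yes cheap = inj₁ (x , (λ w≡0 → contradiction (trans (sym w≡) w≡0) λ ()) , cheap)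
  ...   | suc u | no  dear  = inj₂ (begin
    (suc u + ∑ xs w) * suc K                              ≡⟨ *-distribʳ-+ (suc K) (suc u) (∑ xs w) ⟩
    suc u * suc K + ∑ xs w * suc K                        ≤⟨ +-mono-≤ (*-monoʳ-≤ (suc u) (≰⇒> dear)) heavy ⟩
    suc u * (N * f x) + N * S                             ≡⟨ regroup (suc u) N (f x) S ⟩
    N * (suc u * f x + S)                                 ∎)
    where
    open ≤-Reasoning
    S = ∑[ y ∈ xs ] (w y * f y)
    regroup : ∀ a n b s → a * (n * b) + n * s ≡ n * (a * b + s)
    regroup = solve-∀

  -- With `N` the total weight, the heavy alternative would yield `suc K ≤ K` after cancelling.
  below-average : ∀ (xs : List X) (w f : X → ℕ) {K} → ∑ xs w ≢ 0 → ∑[ x ∈ xs ] (w x * f x) ≤ K →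
    ∃[ x ] (w x ≢ 0 × ∑ xs w * f x ≤ K)
  below-average xs w f {K} ∑w≢0 ≤K with light-or-heavy xs w f (∑ xs w) K
  ... | inj₁ found = found
  ... | inj₂ heavy = contradiction
    (*-cancelˡ-≤ (∑ xs w) {{ℕ.≢-nonZero ∑w≢0}} (≤-trans heavy (*-monoʳ-≤ (∑ xs w) ≤K)))
    1+n≰n

-- Costs of single steps and of sequences of configurations

module _ {k : ℕ} where

  retrieved≤1 : ∀ (prev cur : Config k) s → retrieved prev cur s ≤ 1
  retrieved≤1 prev cur s with cur s
  ... | nothing = z≤n
  ... | just p with Maybeₚ.≡-dec ℕ._≟_ (prev s) (just p)
  ...   | yes _ = z≤n
  ...   | no  _ = ≤-refl

  retrieved-unchanged : ∀ (prev cur : Config k) s → prev s ≡ cur s → retrieved prev cur s ≡ 0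
  retrieved-unchanged prev cur s same with cur s
  ... | nothing = refl
  ... | just p with Maybeₚ.≡-dec ℕ._≟_ (prev s) (just p)
  ...   | yes _     = refl
  ...   | no  differ = contradiction same differ

  retrieved-new : ∀ (prev cur : Config k) s {p} → cur s ≡ just p → prev s ≢ just p → retrieved prev cur s ≡ 1
  retrieved-new prev cur s {p} cur≡ prev≢ with cur s | cur≡
  ... | just .p | refl with Maybeₚ.≡-dec ℕ._≟_ (prev s) (just p)
  ...   | yes same = contradiction same prev≢
  ...   | no  _    = refl

-- Only the contents of the one slot before and after matter, so costs can be compared between
-- caches of different sizes.
retrieved-local : ∀ {k k′} (prev cur : Config k) (prev′ cur′ : Config k′) s s′ →
  prev s ≡ prev′ s′ → cur s ≡ cur′ s′ → retrieved prev cur s ≡ retrieved prev′ cur′ s′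
retrieved-local prev cur prev′ cur′ s s′ prev≡ cur≡ with cur s | cur′ s′ | cur≡
... | nothing | .nothing | refl = refl
... | just p  | .(just p) | refl
  with Maybeₚ.≡-dec ℕ._≟_ (prev s) (just p) | Maybeₚ.≡-dec ℕ._≟_ (prev′ s′) (just p)
...   | yes _ | yes _ = refl
...   | yes q | no ¬q = contradiction (trans (sym prev≡) q) ¬q
...   | no ¬q | yes q = contradiction (trans prev≡ q) ¬q
...   | no _  | no _  = refl

sum-tabulate-+ : ∀ j {k} (f : Fin (j + k) → ℕ) →
  sum (tabulate f) ≡ sum (tabulate (λ s → f (s ↑ˡ k))) + sum (tabulate (λ s → f (j ↑ʳ s)))
sum-tabulate-+ zero f = refl
sum-tabulate-+ (suc j) f =
  trans (cong (f zero +_) (sum-tabulate-+ j (λ s → f (suc s)))) (sym (+-assoc (f zero) _ _))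

sum-tabulate-≤ : ∀ {k} (f : Fin k → ℕ) → (∀ s → f s ≤ 1) → sum (tabulate f) ≤ k
sum-tabulate-≤ {zero} f f≤1 = z≤n
sum-tabulate-≤ {suc k} f f≤1 = +-mono-≤ (f≤1 zero) (sum-tabulate-≤ (λ s → f (suc s)) (λ s → f≤1 (suc s)))

sum-tabulate-0 : ∀ {k} (f : Fin k → ℕ) → (∀ s → f s ≡ 0) → sum (tabulate f) ≡ 0
sum-tabulate-0 {zero} f f≡0 = refl
sum-tabulate-0 {suc k} f f≡0 = cong₂ _+_ (f≡0 zero) (sum-tabulate-0 (λ s → f (suc s)) (λ s → f≡0 (suc s)))

term≤sum-tabulate : ∀ {k} (f : Fin k → ℕ) s → f s ≤ sum (tabulate f)
term≤sum-tabulate f zero = m≤m+n _ _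
term≤sum-tabulate f (suc s) = ≤-trans (term≤sum-tabulate (λ s → f (suc s)) s) (m≤n+m _ (f zero))

sum-tabulate-single : ∀ {k} (f : Fin k → ℕ) s₀ → (∀ s → s ≢ s₀ → f s ≡ 0) → sum (tabulate f) ≡ f s₀
sum-tabulate-single f zero f≡0 =
  trans (cong (f zero +_) (sum-tabulate-0 (λ s → f (suc s)) (λ s → f≡0 (suc s) λ ()))) (+-identityʳ (f zero))
sum-tabulate-single f (suc s₀) f≡0 =
  cong₂ _+_ (f≡0 zero λ ()) (sum-tabulate-single (λ s → f (suc s)) s₀ (λ s s≢ → f≡0 (suc s) λ { refl → s≢ refl }))

stepCost≡ : ∀ {k} (prev cur : Config k) → stepCost prev cur ≡ sum (tabulate (retrieved prev cur))
stepCost≡ prev cur = cong sum (map-tabulate (λ s → s) (retrieved prev cur))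

stepCost≤k : ∀ {k} (prev cur : Config k) → stepCost prev cur ≤ k
stepCost≤k prev cur = ≤-trans (≤-reflexive (stepCost≡ prev cur)) (sum-tabulate-≤ _ (retrieved≤1 prev cur))

stepCost-unchanged : ∀ {k} (prev cur : Config k) → (∀ s → prev s ≡ cur s) → stepCost prev cur ≡ 0
stepCost-unchanged prev cur same =
  trans (stepCost≡ prev cur) (sum-tabulate-0 _ (λ s → retrieved-unchanged prev cur s (same s)))

stepCost-single : ∀ {k} (prev cur : Config k) s₀ → (∀ s → s ≢ s₀ → prev s ≡ cur s) → stepCost prev cur ≤ 1
stepCost-single prev cur s₀ same = begin
  stepCost prev cur                     ≡⟨ stepCost≡ prev cur ⟩
  sum (tabulate (retrieved prev cur))   ≡⟨ sum-tabulate-single _ s₀ (λ s s≢ → retrieved-unchanged prev cur s (same s s≢)) ⟩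
  retrieved prev cur s₀                 ≤⟨ retrieved≤1 prev cur s₀ ⟩
  1                                     ∎
  where open ≤-Reasoning

-- Only the first step sees the start, and it costs at most `k`. This pays for loading an offline
-- solution into the empty cache.
costFrom-change-start : ∀ {k} (prev prev′ : Config k) Γs → costFrom prev Γs ≤ k + costFrom prev′ Γs
costFrom-change-start prev prev′ [] = z≤n
costFrom-change-start prev prev′ (Γ ∷ Γs) =
  +-mono-≤ (stepCost≤k prev Γ) (m≤n+m _ (stepCost prev′ Γ))

-- A pool of offline solutions, of total multiplicity N: solution x only ever occupies conf x true or conf x false,
-- and a single request forces solutions of total multiplicity at most h to move.
record Adversary (k m N h : ℕ) : Set₁ where
  field
    Index        : Set
    indices      : List Index
    weight       : Index → ℕ
    total        : ∑ indices weight ≡ N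
    conf         : Index → Bool → Config k
    conf-near    : ∀ x b → stepCost (conf x b) (conf x (not b)) ≤ 1
    Req          : Set
    request      : Req → Request k (OneOutOf k m)
    hit          : Index → Req → ℕ
    hits-bounded : ∀ ρ → ∑[ x ∈ indices ] (weight x * hit x ρ) ≤ h
    served       : ∀ x → weight x ≢ 0 → ∀ ρ b → Satisfies (conf x b) (request ρ)
                     ⊎ (1 ≤ hit x ρ × Satisfies (conf x (not b)) (request ρ))
    defeat       : ∀ (Γ : Config k) → ∃[ ρ ] ¬ Satisfies Γ (request ρ)

-- The adversary against a fixed algorithm

module Game {k m N h : ℕ} (𝒜 : Adversary k m N h) (A : OnlineAlg k (OneOutOf k m)) where
  open Adversary 𝒜

  -- `Γ` stands for the cache of `A` after `hist`. As `A` is deterministic, the adaptive choices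
  -- amount to a request sequence fixed in advance.
  play : ℕ → Config k → List (Request k (OneOutOf k m)) → List Req
  play zero    Γ hist = []
  play (suc T) Γ hist = ρ ∷ play T (step A hist (request ρ)) (hist ++ [ request ρ ])
    where ρ = proj₁ (defeat Γ)

  play-costs-algorithm : ∀ T Γ hist → T ≤ costFrom Γ (runFrom A hist (map request (play T Γ hist)))
  play-costs-algorithm zero Γ hist = z≤n
  play-costs-algorithm (suc T) Γ hist = +-mono-≤ fault (play-costs-algorithm T Γ′ _)
    where
    ρ = proj₁ (defeat Γ)
    Γ′ = step A hist (request ρ)
    fault : 1 ≤ stepCost Γ Γ′
    -- The slot that serves the request now did not hold the page before, because `defeat` chose a
    -- request that `Γ` does not satisfy.
    fault with valid A hist (request ρ)
    ... | s , s∈S , Γ′s≡p = begin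
      1                                   ≡⟨ retrieved-new Γ Γ′ s Γ′s≡p (λ Γs≡p → proj₂ (defeat Γ) (s , s∈S , Γs≡p)) ⟨
      retrieved Γ Γ′ s                    ≤⟨ term≤sum-tabulate (retrieved Γ Γ′) s ⟩
      sum (tabulate (retrieved Γ Γ′))     ≡⟨ stepCost≡ Γ Γ′ ⟨
      stepCost Γ Γ′                       ∎
      where open ≤-Reasoning

  module _ (x : Index) (wx≢0 : weight x ≢ 0) where

    -- The lazy solution of index `x`: it leaves its current configuration only when `served`
    -- demands it, so that every move is charged to a hit.
    follow : Bool → List Req → List (Config k)
    follow b [] = []
    follow b (ρ ∷ ρs) with served x wx≢0 ρ b
    ... | inj₁ _ = conf x b ∷ follow b ρs
    ... | inj₂ _ = conf x (not b) ∷ follow (not b) ρs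

    follow-isSolution : ∀ b ρs → IsSolution (map request ρs) (follow b ρs)
    follow-isSolution b [] = []
    follow-isSolution b (ρ ∷ ρs) with served x wx≢0 ρ b
    ... | inj₁ sat       = sat ∷ follow-isSolution b ρs
    ... | inj₂ (_ , sat) = sat ∷ follow-isSolution (not b) ρs

    follow-cost : ∀ b ρs → costFrom (conf x b) (follow b ρs) ≤ ∑ ρs (hit x)
    follow-cost b [] = z≤n
    follow-cost b (ρ ∷ ρs) with served x wx≢0 ρ b
    ... | inj₁ _ = +-mono-≤ (≤-trans (≤-reflexive (stepCost-unchanged (conf x b) (conf x b) (λ _ → refl))) z≤n)
                            (follow-cost b ρs)
    ... | inj₂ (struck , _) = +-mono-≤ (≤-trans (conf-near x b) struck) (follow-cost (not b) ρs)

    follow-total-cost : ∀ ρs → cost (follow true ρs) ≤ k + ∑ ρs (hit x)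
    follow-total-cost ρs =
      ≤-trans (costFrom-change-start _ (conf x true) (follow true ρs)) (+-monoʳ-≤ k (follow-cost true ρs))

  -- Each request adds at most `h` to the weighted total by `hits-bounded`; the term `N * k` covers
  -- the initial loading of all solutions.
  pool-cost : ∀ T Γ hist →
    ∑[ x ∈ indices ] (weight x * (k + ∑ (play T Γ hist) (hit x))) ≤ N * k + T * h
  pool-cost zero Γ hist = ≤-reflexive (begin
    ∑[ x ∈ indices ] (weight x * (k + 0))  ≡⟨ *-distribʳ-∑ indices weight (k + 0) ⟩
    ∑ indices weight * (k + 0)             ≡⟨ cong₂ _*_ total (+-identityʳ k) ⟩
    N * k                                  ≡⟨ +-identityʳ (N * k) ⟨
    N * k + 0                              ∎)
    where open ≡-Reasoning
  pool-cost (suc T) Γ hist = begin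
    ∑[ x ∈ indices ] (weight x * (k + (hit x ρ + ∑ ρs (hit x))))
      ≡⟨ ∑-cong indices (λ x → regroup (weight x) k (hit x ρ) (∑ ρs (hit x))) ⟩
    ∑[ x ∈ indices ] (weight x * hit x ρ + weight x * (k + ∑ ρs (hit x)))
      ≡⟨ ∑-distrib-+ indices (λ x → weight x * hit x ρ) _ ⟩
    ∑[ x ∈ indices ] (weight x * hit x ρ) + ∑[ x ∈ indices ] (weight x * (k + ∑ ρs (hit x)))
      ≤⟨ +-mono-≤ (hits-bounded ρ) (pool-cost T _ _) ⟩
    h + (N * k + T * h)
      ≡⟨ regroup′ h (N * k) (T * h) ⟩
    N * k + (h + T * h) ∎
    where
    open ≤-Reasoning
    ρ = proj₁ (defeat Γ)
    ρs = play T (step A hist (request ρ)) (hist ++ [ request ρ ])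
    regroup : ∀ w k a b → w * (k + (a + b)) ≡ w * a + w * (k + b)
    regroup = solve-∀
    regroup′ : ∀ a b c → a + (b + c) ≡ b + (a + c)
    regroup′ = solve-∀

  competitive⇒N≤c*h : N ≢ 0 → ∀ c → IsCompetitive A c → ℕ→ℚ N ℚ.≤ c ℚ.* ℕ→ℚ h
  competitive⇒N≤c*h N≢0 c (b , competitive) = rate-bound N h k c b bound
    where
    bound : ∀ T → ∃[ f ] (ℕ→ℚ T ℚ.≤ c ℚ.* ℕ→ℚ f ℚ.+ b × N * f ≤ N * k + T * h)
    bound T with play T emptyConfig [] | play-costs-algorithm T emptyConfig [] | pool-cost T emptyConfig []
    -- The offline solution is picked in hindsight, as a member of the pool that costs no more than
    -- the weighted average.
    ... | ρs | T≤cost | pool≤ with below-average indices weight _ (λ ∑≡0 → N≢0 (trans (sym total) ∑≡0)) pool≤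
    ...   | x , wx≢0 , Nf≤ =
      cost (follow x wx≢0 true ρs)
      , ℚₚ.≤-trans (ℕ→ℚ-mono-≤ T≤cost) (competitive (map request ρs) _ (follow-isSolution x wx≢0 true ρs))
      , ≤-trans (*-mono-≤ (≤-reflexive (sym total)) (follow-total-cost x wx≢0 ρs)) Nf≤

adversary⇒lowerBound : ∀ {k m N h} → Adversary k m N h → N ≢ 0 → .{{_ : NonZero h}} →
  ∀ L → L ℚ.* ℕ→ℚ h ≡ ℕ→ℚ N → OptRatioAtLeast k (OneOutOf k m) L
adversary⇒lowerBound {h = h} 𝒜 N≢0 L Lh≡N c (A , competitive) =
  ℚₚ.*-cancelʳ-≤-pos (ℕ→ℚ h) {{ℕ→ℚ-pos h}}
    (ℚₚ.≤-trans (ℚₚ.≤-reflexive Lh≡N) (Game.competitive⇒N≤c*h 𝒜 A N≢0 c competitive))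

-- Covers even k in part (i): no request touches the new slot, so whatever an algorithm stores there
-- cannot serve any of them, and the offline solutions leave it empty.
unusedSlot : ∀ {k m N h} → Adversary k m N h → Adversary (suc k) m N h
unusedSlot {k} {m} 𝒜 = record
  { Index = Index ; indices = indices ; weight = weight ; total = total
  ; conf = λ x b → extend (conf x b)
  ; conf-near = λ x b → ≤-trans (≤-reflexive (stepCost-extend (conf x b) (conf x (not b)))) (conf-near x b)
  ; Req = Req
  ; request = λ ρ → extendRequest (request ρ)
  ; hit = hit ; hits-bounded = hits-bounded
  ; served = λ x w ρ b → Sum.map (extend-sat _ (request ρ)) (λ (h , s) → h , extend-sat _ (request ρ) s) (served x w ρ b)
  ; defeat = λ Γ → let ρ , unsat = defeat (λ s → Γ (suc s)) in
      ρ , λ { (suc s , there s∈S , Γs≡) → unsat (s , s∈S , Γs≡) }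
  }
  where
  open Adversary 𝒜
  extend : Config k → Config (suc k)
  extend Γ zero    = nothing
  extend Γ (suc s) = Γ s
  extendRequest : Request k (OneOutOf k m) → Request (suc k) (OneOutOf (suc k) m)
  extendRequest (p , S , ∣S∣≡m) = p , outside ∷ S , ∣S∣≡m
  extend-sat : ∀ Γ r → Satisfies Γ r → Satisfies (extend Γ) (extendRequest r)
  extend-sat Γ r (s , s∈S , Γs≡) = suc s , there s∈S , Γs≡
  stepCost-extend : ∀ Γ Γ′ → stepCost (extend Γ) (extend Γ′) ≡ stepCost Γ Γ′
  stepCost-extend Γ Γ′ = trans (stepCost≡ (extend Γ) (extend Γ′))
    (trans (cong sum (tabulate-cong (λ s → retrieved-local (extend Γ) (extend Γ′) Γ Γ′ (suc s) s refl refl)))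
      (sym (stepCost≡ Γ Γ′)))

-- Two-coloured states and their matching

∑-const : ∀ {X : Set} (xs : List X) c → ∑[ _ ∈ xs ] c ≡ length xs * c
∑-const [] c = refl
∑-const (x ∷ xs) c = cong (c +_) (∑-const xs c)

∑-++ : ∀ {X : Set} (xs ys : List X) f → ∑ (xs ++ ys) f ≡ ∑ xs f + ∑ ys f
∑-++ xs ys f = trans (cong sum (map-++ f xs ys)) (sum-++ (map f xs) (map f ys))

∑-cartesianProductWith : ∀ {X Y Z : Set} (_∙_ : X → Y → Z) xs ys f →
  ∑ (cartesianProductWith _∙_ xs ys) f ≡ ∑[ x ∈ xs ] (∑[ y ∈ ys ] (f (x ∙ y)))
∑-cartesianProductWith _∙_ [] ys f = refl
∑-cartesianProductWith _∙_ (x ∷ xs) ys f = trans (∑-++ (map (x ∙_) ys) _ f)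
  (cong₂ _+_ (cong sum (sym (map-∘ ys))) (∑-cartesianProductWith _∙_ xs ys f))

∑-allFin-const : ∀ J c → ∑[ _ ∈ allFin J ] c ≡ J * c
∑-allFin-const J c = trans (∑-const (allFin J) c) (cong (_* c) (length-tabulate {n = J} (λ i → i)))

-- Kronecker's delta. Indicators take values in ℕ here, so that counting states becomes summation.
δ : ∀ {J} → Fin J → Fin J → ℕ
δ zero    zero    = 1
δ zero    (suc _) = 0
δ (suc _) zero    = 0
δ (suc i) (suc j) = δ i j

δ-refl : ∀ {J} (i : Fin J) → δ i i ≡ 1
δ-refl zero    = refl
δ-refl (suc i) = δ-refl i

δ-≢ : ∀ {J} (i j : Fin J) → j ≢ i → δ i j ≡ 0
δ-≢ zero    zero    i≢j = contradiction refl i≢j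
δ-≢ zero    (suc _) i≢j = refl
δ-≢ (suc _) zero    i≢j = refl
δ-≢ (suc i) (suc j) i≢j = δ-≢ i j λ { refl → i≢j refl }

∑-δ : ∀ {J} (i : Fin J) → ∑ (allFin J) (δ i) ≡ 1
∑-δ i = trans (cong sum (map-tabulate (λ s → s) (δ i)))
  (trans (sum-tabulate-single (δ i) i (λ j j≢i → δ-≢ i j j≢i)) (δ-refl i))

δℕ : ℕ → ℕ → ℕ
δℕ zero    zero    = 1
δℕ zero    (suc _) = 0
δℕ (suc _) zero    = 0
δℕ (suc a) (suc b) = δℕ a b

δℕ≤1 : ∀ a b → δℕ a b ≤ 1
δℕ≤1 zero    zero    = ≤-refl
δℕ≤1 zero    (suc _) = z≤n
δℕ≤1 (suc _) zero    = z≤n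
δℕ≤1 (suc a) (suc b) = δℕ≤1 a b

δℕ≢0⇒≡ : ∀ a b → δℕ a b ≢ 0 → a ≡ b
δℕ≢0⇒≡ zero    zero    _  = refl
δℕ≢0⇒≡ zero    (suc _) ≢0 = contradiction refl ≢0
δℕ≢0⇒≡ (suc _) zero    ≢0 = contradiction refl ≢0
δℕ≢0⇒≡ (suc a) (suc b) ≢0 = cong suc (δℕ≢0⇒≡ a b ≢0)

positive? : ℕ → ℕ
positive? zero    = 0
positive? (suc _) = 1

agree : Bool → Bool → ℕ
agree true  true  = 1
agree true  false = 0
agree false true  = 0
agree false false = 1

agree-refl : ∀ p → agree p p ≡ 1
agree-refl true  = refl
agree-refl false = refl

agree-select : ∀ p x → agree p true * x + agree p false * x ≡ x
agree-select true  x = trans (+-identityʳ (1 * x)) (*-identityˡ x)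
agree-select false x = *-identityˡ x

*-distribˡ-∑ : ∀ {X : Set} (xs : List X) (f : X → ℕ) c → ∑[ x ∈ xs ] (c * f x) ≡ c * ∑ xs f
*-distribˡ-∑ xs f c =
  trans (∑-cong xs (λ x → *-comm c (f x))) (trans (*-distribʳ-∑ xs f c) (*-comm (∑ xs f) c))

module _ {J : ℕ} where

  State : ℕ → Set
  State r = Vec (Bool × Fin J) r

  cells : List (Bool × Fin J)
  cells = cartesianProductWith (λ i p → p , i) (allFin J) (true ∷ false ∷ [])

  states : ∀ r → List (State r)
  states zero    = [] ∷ []
  states (suc r) = cartesianProductWith _∷_ cells (states r)

  ∑-states-suc : ∀ r (f : State (suc r) → ℕ) → ∑ (states (suc r)) f
    ≡ ∑[ i ∈ allFin J ] (∑[ w ∈ states r ] (f ((true , i) ∷ w)) + ∑[ w ∈ states r ] (f ((false , i) ∷ w)))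
  ∑-states-suc r f = trans (∑-cartesianProductWith _∷_ cells (states r) f)
    (trans (∑-cartesianProductWith (λ i p → p , i) (allFin J) (true ∷ false ∷ []) (λ c → ∑[ w ∈ states r ] (f (c ∷ w))))
      (∑-cong (allFin J) λ i → cong (∑[ w ∈ states r ] (f ((true , i) ∷ w)) +_) (+-identityʳ _)))

  count : ∀ {r} → Bool → State r → ℕ
  count p []            = 0
  count p ((q , _) ∷ w) = agree p q + count p w

  count-true+false : ∀ {r} (x : State r) → count true x + count false x ≡ r
  count-true+false []                = refl
  count-true+false ((true , _) ∷ w)  = cong suc (count-true+false w)
  count-true+false ((false , _) ∷ w) = trans (+-suc _ _) (cong suc (count-true+false w))

  -- The binomial coefficient chooses the groups of colour `true`, and every group has a free index.
  -- The recursion is Pascal's rule.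
  number-of-states : ∀ r n → ∑[ x ∈ states r ] (δℕ (count true x) n) ≡ (r C n) * J ^ r
  number-of-states zero zero    = refl
  number-of-states zero (suc n) = refl
  number-of-states (suc r) zero = begin
    ∑[ x ∈ states (suc r) ] (δℕ (count true x) 0)
      ≡⟨ ∑-states-suc r _ ⟩
    ∑[ i ∈ allFin J ] (∑[ _ ∈ states r ] 0 + ∑[ w ∈ states r ] (δℕ (count true w) 0))
      ≡⟨ ∑-allFin-const J _ ⟩
    J * (∑[ _ ∈ states r ] 0 + ∑[ w ∈ states r ] (δℕ (count true w) 0))
      ≡⟨ cong₂ (λ u v → J * (u + v)) (trans (∑-const (states r) 0) (*-zeroʳ (length (states r)))) (number-of-states r zero) ⟩
    J * (1 * J ^ r)
      ≡⟨ cong (J *_) (*-identityˡ (J ^ r)) ⟩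
    J ^ suc r
      ≡⟨ *-identityˡ (J ^ suc r) ⟨
    1 * J ^ suc r ∎
    where open ≡-Reasoning
  number-of-states (suc r) (suc n) = begin
    ∑[ x ∈ states (suc r) ] (δℕ (count true x) (suc n))
      ≡⟨ ∑-states-suc r _ ⟩
    ∑[ i ∈ allFin J ] (∑[ w ∈ states r ] (δℕ (count true w) n) + ∑[ w ∈ states r ] (δℕ (count true w) (suc n)))
      ≡⟨ ∑-allFin-const J _ ⟩
    J * (∑[ w ∈ states r ] (δℕ (count true w) n) + ∑[ w ∈ states r ] (δℕ (count true w) (suc n)))
      ≡⟨ cong₂ (λ u v → J * (u + v)) (number-of-states r n) (number-of-states r (suc n)) ⟩
    J * ((r C n) * J ^ r + (r C suc n) * J ^ r)
      ≡⟨ regroup J (r C n) (r C suc n) (J ^ r) ⟩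
    ((r C n) + (r C suc n)) * J ^ suc r
      ≡⟨ cong (_* J ^ suc r) (nCk+nC[k+1]≡[n+1]C[k+1] r n) ⟩
    (suc r C suc n) * J ^ suc r ∎
    where
    open ≡-Reasoning
    regroup : ∀ j a b x → j * (a * x + b * x) ≡ (a + b) * (j * x)
    regroup = solve-∀

  -- A vector of `Maybe (Fin J)` is a request pattern: `just i` asks for the block of index `i` in
  -- that group, `nothing` leaves the group untouched.
  justs : ∀ {r} → Vec (Maybe (Fin J)) r → ℕ
  justs []            = 0
  justs (just _ ∷ ρ)  = suc (justs ρ)
  justs (nothing ∷ ρ) = justs ρ

  nothings : ∀ {r} → Vec (Maybe (Fin J)) r → ℕ
  nothings []            = 0
  nothings (just _ ∷ ρ)  = nothings ρ
  nothings (nothing ∷ ρ) = suc (nothings ρ)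

  justs+nothings : ∀ {r} (ρ : Vec (Maybe (Fin J)) r) → justs ρ + nothings ρ ≡ r
  justs+nothings []            = refl
  justs+nothings (just _ ∷ ρ)  = cong suc (justs+nothings ρ)
  justs+nothings (nothing ∷ ρ) = trans (+-suc _ _) (cong suc (justs+nothings ρ))

  -- Indicator of the states that have colour `p` exactly on the touched groups, with the requested
  -- index there; the index in an untouched group is free.
  matches : ∀ {r} → Bool → Vec (Maybe (Fin J)) r → State r → ℕ
  matches p []            []             = 1
  matches p (just i ∷ ρ)  ((q , i′) ∷ w) = agree p q * δ i i′ * matches p ρ w
  matches p (nothing ∷ ρ) ((q , _) ∷ w)  = agree (not p) q * matches p ρ w

  -- All colours are forced, and so are the indices of the touched groups; only the indices of the
  -- untouched ones can be chosen.
  number-of-matches : ∀ {r} p (ρ : Vec (Maybe (Fin J)) r) → ∑ (states r) (matches p ρ) ≡ J ^ nothings ρ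
  number-of-matches p [] = refl
  number-of-matches {suc r} p (just i ∷ ρ) = begin
    ∑ (states (suc r)) (matches p (just i ∷ ρ))
      ≡⟨ ∑-states-suc r _ ⟩
    ∑[ i′ ∈ allFin J ] (∑[ w ∈ states r ] (agree p true * δ i i′ * matches p ρ w)
                      + ∑[ w ∈ states r ] (agree p false * δ i i′ * matches p ρ w))
      ≡⟨ ∑-cong (allFin J) (λ i′ → trans
           (cong₂ _+_ (*-distribˡ-∑ (states r) (matches p ρ) (agree p true * δ i i′)) (*-distribˡ-∑ (states r) (matches p ρ) (agree p false * δ i i′)))
           (trans (cong₂ _+_ (*-assoc (agree p true) (δ i i′) M) (*-assoc (agree p false) (δ i i′) M)) (agree-select p (δ i i′ * M)))) ⟩
    ∑[ i′ ∈ allFin J ] (δ i i′ * M)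
      ≡⟨ *-distribʳ-∑ (allFin J) (δ i) M ⟩
    ∑ (allFin J) (δ i) * M
      ≡⟨ cong (_* M) (∑-δ i) ⟩
    1 * M
      ≡⟨ *-identityˡ M ⟩
    M
      ≡⟨ number-of-matches p ρ ⟩
    J ^ nothings ρ ∎
    where
    open ≡-Reasoning
    M = ∑ (states r) (matches p ρ)
  number-of-matches {suc r} p (nothing ∷ ρ) = begin
    ∑ (states (suc r)) (matches p (nothing ∷ ρ))
      ≡⟨ ∑-states-suc r _ ⟩
    ∑[ i ∈ allFin J ] (∑[ w ∈ states r ] (agree (not p) true * matches p ρ w)
                     + ∑[ w ∈ states r ] (agree (not p) false * matches p ρ w))
      ≡⟨ ∑-allFin-const J _ ⟩
    J * (∑[ w ∈ states r ] (agree (not p) true * matches p ρ w) + ∑[ w ∈ states r ] (agree (not p) false * matches p ρ w))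
      ≡⟨ cong (J *_) (trans (cong₂ _+_ (*-distribˡ-∑ (states r) (matches p ρ) (agree (not p) true)) (*-distribˡ-∑ (states r) (matches p ρ) (agree (not p) false))) (agree-select (not p) M)) ⟩
    J * M
      ≡⟨ cong (J *_) (number-of-matches p ρ) ⟩
    J ^ suc (nothings ρ) ∎
    where
    open ≡-Reasoning
    M = ∑ (states r) (matches p ρ)

  -- Read true as an up-step and false as a down-step: the greatest height that the path reaches.
  height : ∀ {r} → State r → ℕ
  height []                = 0
  height ((true , _) ∷ w)  = suc (height w)
  height ((false , _) ∷ w) = pred (height w)

  -- Turns the first step reaching the greatest height into a down-step; this is the usual
  -- bracket matching between adjacent levels of the Boolean lattice.
  partner : ∀ {r} → State r → State r
  partner []                = []
  partner ((true , i) ∷ w)  with height w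
  ... | zero  = (false , i) ∷ w
  ... | suc _ = (true , i) ∷ partner w
  partner ((false , i) ∷ w) = (false , i) ∷ partner w

  -- Lets `∑-partner` express a condition on `height w` as one on the partner, to which the
  -- induction hypothesis applies.
  height-partner : ∀ {r} (x : State r) → height (partner x) ≡ pred (height x)
  height-partner []                = refl
  height-partner ((true , i) ∷ w)  with height w in h≡
  ... | zero  = cong pred h≡
  ... | suc _ = cong suc (trans (height-partner w) (cong pred h≡))
  height-partner ((false , i) ∷ w) = cong pred (height-partner w)

  -- The end point of the path is no higher than its greatest height. Hence a surplus of `true`
  -- forces positive height, which is where `partner` turns a step.
  count-true≤count-false+height : ∀ {r} (x : State r) → count true x ≤ count false x + height x
  count-true≤count-false+height []                = z≤n
  count-true≤count-false+height ((true , _) ∷ w)  =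
    subst (suc (count true w) ≤_) (sym (+-suc (count false w) (height w))) (s≤s (count-true≤count-false+height w))
  count-true≤count-false+height ((false , _) ∷ w) = begin
    count true w                              ≤⟨ count-true≤count-false+height w ⟩
    count false w + height w                  ≤⟨ +-monoʳ-≤ (count false w) (n≤1+pred (height w)) ⟩
    count false w + suc (pred (height w))     ≡⟨ +-suc (count false w) _ ⟩
    suc (count false w + pred (height w))     ∎
    where
    open ≤-Reasoning
    n≤1+pred : ∀ n → n ≤ suc (pred n)
    n≤1+pred zero    = z≤n
    n≤1+pred (suc n) = ≤-refl

  count-true-partner : ∀ {r} (x : State r) → 1 ≤ height x → suc (count true (partner x)) ≡ count true x
  count-true-partner ((true , i) ∷ w)  _ with height w in h≡
  ... | zero  = refl
  ... | suc _ = cong suc (count-true-partner w (subst (1 ≤_) (sym h≡) (s≤s z≤n)))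
  count-true-partner ((false , i) ∷ w) 1≤h = count-true-partner w (≤-trans 1≤h pred[n]≤n)

  -- Σ over x with height x ≥ 1, i.e. partner is injective there.  In the induction step the states false ∷ w
  -- arise as partners both of true ∷ w with height w = 0 and of false ∷ w′ with height w = height w′ - 1 ≥ 1.
  ∑-partner : ∀ r (g : State r → ℕ) → ∑[ x ∈ states r ] (positive? (height x) * g (partner x)) ≤ ∑ (states r) g
  ∑-partner zero g = z≤n
  ∑-partner (suc r) g = begin
    ∑[ x ∈ states (suc r) ] (positive? (height x) * g (partner x))
      ≡⟨ ∑-states-suc r _ ⟩
    ∑[ i ∈ allFin J ] (∑[ w ∈ states r ] (1 * g (partner ((true , i) ∷ w)))
                     + ∑[ w ∈ states r ] (positive? (pred (height w)) * g ((false , i) ∷ partner w)))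
      ≤⟨ ∑-mono (allFin J) each ⟩
    ∑[ i ∈ allFin J ] (∑[ w ∈ states r ] (g ((true , i) ∷ w)) + ∑[ w ∈ states r ] (g ((false , i) ∷ w)))
      ≡⟨ ∑-states-suc r g ⟨
    ∑ (states (suc r)) g ∎
    where
    open ≤-Reasoning
    zero? : ℕ → ℕ
    zero? zero    = 1
    zero? (suc _) = 0
    split : ∀ i w → 1 * g (partner ((true , i) ∷ w))
          ≡ positive? (height w) * g ((true , i) ∷ partner w) + zero? (height w) * g ((false , i) ∷ w)
    split i w with height w
    ... | zero  = refl
    ... | suc _ = sym (+-identityʳ _)
    lower : ∀ i w → positive? (pred (height w)) * g ((false , i) ∷ partner w)
          ≡ positive? (height w) * (positive? (height (partner w)) * g ((false , i) ∷ partner w))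
    lower i w rewrite height-partner w with height w
    ... | zero  = refl
    ... | suc _ = sym (*-identityˡ _)
    zero?+positive? : ∀ n x → zero? n * x + positive? n * x ≡ x
    zero?+positive? zero    x = trans (+-identityʳ (1 * x)) (*-identityˡ x)
    zero?+positive? (suc _) x = *-identityˡ x
    each : ∀ i → ∑[ w ∈ states r ] (1 * g (partner ((true , i) ∷ w)))
                 + ∑[ w ∈ states r ] (positive? (pred (height w)) * g ((false , i) ∷ partner w))
               ≤ ∑[ w ∈ states r ] (g ((true , i) ∷ w)) + ∑[ w ∈ states r ] (g ((false , i) ∷ w))
    each i = begin
      ∑[ w ∈ states r ] (1 * g (partner ((true , i) ∷ w)))
        + ∑[ w ∈ states r ] (positive? (pred (height w)) * gᶠ (partner w))
        ≡⟨ cong₂ _+_ (trans (∑-cong (states r) (split i)) (∑-distrib-+ (states r) (λ w → positive? (height w) * gᵗ (partner w)) _))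
                     (∑-cong (states r) (lower i)) ⟩
      ∑[ w ∈ states r ] (positive? (height w) * gᵗ (partner w)) + ∑[ w ∈ states r ] (zero? (height w) * gᶠ w)
        + ∑[ w ∈ states r ] (positive? (height w) * (positive? (height (partner w)) * gᶠ (partner w)))
        -- The induction hypothesis is used twice, the second time for `gᶠ` restricted to positive
        -- height. This leaves room for the terms of height 0, which come from `true ∷ w`.
        ≤⟨ +-mono-≤ (+-monoˡ-≤ _ (∑-partner r gᵗ)) (∑-partner r (λ y → positive? (height y) * gᶠ y)) ⟩
      ∑ (states r) gᵗ + ∑[ w ∈ states r ] (zero? (height w) * gᶠ w) + ∑[ w ∈ states r ] (positive? (height w) * gᶠ w)
        ≡⟨ +-assoc (∑ (states r) gᵗ) _ _ ⟩
      ∑ (states r) gᵗ + (∑[ w ∈ states r ] (zero? (height w) * gᶠ w) + ∑[ w ∈ states r ] (positive? (height w) * gᶠ w))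
        ≡⟨ cong (∑ (states r) gᵗ +_) (trans (sym (∑-distrib-+ (states r) (λ w → zero? (height w) * gᶠ w) _))
             (∑-cong (states r) (λ w → zero?+positive? (height w) (gᶠ w)))) ⟩
      ∑ (states r) gᵗ + ∑ (states r) gᶠ ∎
      where
      gᵗ gᶠ : State r → ℕ
      gᵗ w = g ((true , i) ∷ w)
      gᶠ w = g ((false , i) ∷ w)

-- From one group to many

∣S++S′∣ : ∀ {j k} (S : Subset j) (S′ : Subset k) → ∣ S Vec.++ S′ ∣ ≡ ∣ S ∣ + ∣ S′ ∣
∣S++S′∣ []          S′ = refl
∣S++S′∣ (true ∷ S)  S′ = cong suc (∣S++S′∣ S S′)
∣S++S′∣ (false ∷ S) S′ = ∣S++S′∣ S S′

∈-++ˡ : ∀ {j k} {S : Subset j} (S′ : Subset k) {s} → s ∈ S → (s ↑ˡ k) ∈ (S Vec.++ S′)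
∈-++ˡ S′ here      = here
∈-++ˡ S′ (there p) = there (∈-++ˡ S′ p)

∈-++ʳ : ∀ {j k} (S : Subset j) {S′ : Subset k} {s} → s ∈ S′ → (j ↑ʳ s) ∈ (S Vec.++ S′)
∈-++ʳ []      p = p
∈-++ʳ (_ ∷ S) p = there (∈-++ʳ S p)

∈-++⁻ : ∀ {j k} (S : Subset j) {S′ : Subset k} {s} → s ∈ (S Vec.++ S′) →
  (∃[ u ] (s ≡ u ↑ˡ k × u ∈ S)) ⊎ (∃[ u ] (s ≡ j ↑ʳ u × u ∈ S′))
∈-++⁻ []      {s = s} p = inj₂ (s , refl , p)
∈-++⁻ (_ ∷ S) here = inj₁ (zero , refl , here)
∈-++⁻ (_ ∷ S) (there p) with ∈-++⁻ S p
... | inj₁ (u , refl , u∈S)  = inj₁ (suc u , refl , there u∈S)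
... | inj₂ (u , refl , u∈S′) = inj₂ (u , refl , u∈S′)

page : Bool → ℕ
page false = 0
page true  = 1

-- colour p i assigns one of the two pages to every slot of the group.  A request for page (not p) in block p i
-- is served by all of these 2J configurations except colour p i.
record Gadget (j J t : ℕ) : Set where
  field
    colour      : Bool → Fin J → Fin j → Bool
    block       : Bool → Fin J → Subset j
    block-size  : ∀ p i → ∣ block p i ∣ ≡ t
    colour-near : ∀ i → ∃[ s₀ ] (∀ s → s ≢ s₀ → colour true i s ≡ colour false i s)
    escapes     : ∀ p i q i′ → ((q , i′) ≡ (p , i)) ⊎ (∃[ s ] (s ∈ block p i × colour q i′ s ≡ not p))
    trapped     : ∀ (Γ : Config j) → ∃[ p ] ∃[ i ] (∀ s → s ∈ block p i → Γ s ≢ just (page (not p)))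

module Construction {j J t : ℕ} (𝒢 : Gadget j J t) where
  open Gadget 𝒢

  groupConfig : Bool × Fin J → Config j
  groupConfig (p , i) s = just (page (colour p i s))

  config : ∀ {r} → State {J} r → Config (r * j)
  config (c ∷ w) s = [ groupConfig c , config w ]′ (splitAt j s)

  config-↑ˡ : ∀ {r} c (w : State r) s → config (c ∷ w) (s ↑ˡ (r * j)) ≡ groupConfig c s
  config-↑ˡ {r} c w s = cong [ groupConfig c , config w ]′ (splitAt-↑ˡ j s (r * j))

  config-↑ʳ : ∀ {r} c (w : State r) s → config (c ∷ w) (j ↑ʳ s) ≡ config w s
  config-↑ʳ {r} c w s = cong [ groupConfig c , config w ]′ (splitAt-↑ʳ j (r * j) s)

  stepCost-∷ : ∀ {r} c c′ (w w′ : State r) →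
    stepCost (config (c ∷ w)) (config (c′ ∷ w′)) ≡ stepCost (groupConfig c) (groupConfig c′) + stepCost (config w) (config w′)
  stepCost-∷ {r} c c′ w w′ = begin
    stepCost Γ Γ′
      ≡⟨ stepCost≡ Γ Γ′ ⟩
    sum (tabulate (retrieved Γ Γ′))
      ≡⟨ sum-tabulate-+ j (retrieved Γ Γ′) ⟩
    sum (tabulate (λ s → retrieved Γ Γ′ (s ↑ˡ (r * j)))) + sum (tabulate (λ s → retrieved Γ Γ′ (j ↑ʳ s)))
      ≡⟨ cong₂ (λ u v → sum u + sum v)
           (tabulate-cong (λ s → retrieved-local Γ Γ′ (groupConfig c) (groupConfig c′) _ s (config-↑ˡ c w s) (config-↑ˡ c′ w′ s)))
           (tabulate-cong (λ s → retrieved-local Γ Γ′ (config w) (config w′) _ s (config-↑ʳ c w s) (config-↑ʳ c′ w′ s))) ⟩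
    sum (tabulate (retrieved (groupConfig c) (groupConfig c′))) + sum (tabulate (retrieved (config w) (config w′)))
      ≡⟨ cong₂ _+_ (stepCost≡ (groupConfig c) (groupConfig c′)) (stepCost≡ (config w) (config w′)) ⟨
    stepCost (groupConfig c) (groupConfig c′) + stepCost (config w) (config w′) ∎
    where
    open ≡-Reasoning
    Γ = config (c ∷ w)
    Γ′ = config (c′ ∷ w′)

  flip-cost : ∀ p i → stepCost (groupConfig (p , i)) (groupConfig (not p , i)) ≤ 1
  flip-cost p i with colour-near i
  flip-cost true  i | s₀ , same = stepCost-single _ _ s₀ (λ s s≢ → cong (λ b → just (page b)) (same s s≢))
  flip-cost false i | s₀ , same = stepCost-single _ _ s₀ (λ s s≢ → cong (λ b → just (page b)) (sym (same s s≢)))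

  -- At most one group changes its colour and no index changes. Equality is allowed because
  -- `partner` fixes some states, such as those without `true`.
  data Near : ∀ {r} → State {J} r → State r → Set where
    []   : Near [] []
    flip : ∀ {r} p i (w : State r) → Near ((p , i) ∷ w) ((not p , i) ∷ w)
    keep : ∀ {r} c {w w′ : State r} → Near w w′ → Near (c ∷ w) (c ∷ w′)

  near-sym : ∀ {r} {x y : State r} → Near x y → Near y x
  near-sym [] = []
  near-sym (flip p i w) = subst (λ q → Near ((not p , i) ∷ w) ((q , i) ∷ w)) (not-involutive p) (flip (not p) i w)
  near-sym (keep c n) = keep c (near-sym n)

  near-partner : ∀ {r} (x : State r) → Near x (partner x)
  near-partner [] = []
  near-partner ((true , i) ∷ w) with height w
  ... | zero  = flip true i w
  ... | suc _ = keep (true , i) (near-partner w)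
  near-partner ((false , i) ∷ w) = keep (false , i) (near-partner w)

  near-cost : ∀ {r} {x y : State r} → Near x y → stepCost (config x) (config y) ≤ 1
  near-cost [] = z≤n
  near-cost (flip p i w) = begin
    stepCost (config ((p , i) ∷ w)) (config ((not p , i) ∷ w))
      ≡⟨ stepCost-∷ (p , i) (not p , i) w w ⟩
    stepCost (groupConfig (p , i)) (groupConfig (not p , i)) + stepCost (config w) (config w)
      ≤⟨ +-mono-≤ (flip-cost p i) (≤-reflexive (stepCost-unchanged (config w) (config w) (λ _ → refl))) ⟩
    1 ∎
    where open ≤-Reasoning
  near-cost (keep c {w} {w′} n) = begin
    stepCost (config (c ∷ w)) (config (c ∷ w′))
      ≡⟨ stepCost-∷ c c w w′ ⟩
    stepCost (groupConfig c) (groupConfig c) + stepCost (config w) (config w′)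
      ≤⟨ +-mono-≤ (≤-reflexive (stepCost-unchanged (groupConfig c) (groupConfig c) (λ _ → refl))) (near-cost n) ⟩
    1 ∎
    where open ≤-Reasoning

  slots : ∀ {r} → Bool → Vec (Maybe (Fin J)) r → Subset (r * j)
  slots p []            = []
  slots p (just i ∷ ρ)  = block p i Vec.++ slots p ρ
  slots p (nothing ∷ ρ) = ⊥ {n = j} Vec.++ slots p ρ

  ∣slots∣ : ∀ {r} p (ρ : Vec (Maybe (Fin J)) r) → ∣ slots p ρ ∣ ≡ justs ρ * t
  ∣slots∣ p [] = refl
  ∣slots∣ p (just i ∷ ρ)  = trans (∣S++S′∣ (block p i) (slots p ρ)) (cong₂ _+_ (block-size p i) (∣slots∣ p ρ))
  ∣slots∣ p (nothing ∷ ρ) = trans (∣S++S′∣ (⊥ {n = j}) (slots p ρ)) (cong₂ _+_ (∣⊥∣≡0 j) (∣slots∣ p ρ))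

  Holds : ∀ {k} → Config k → ℕ → Subset k → Set
  Holds Γ q S = ∃[ s ] (s ∈ S × Γ s ≡ just q)

  -- By `escapes` a touched group serves the page unless it is in the cell (`p`, `i`) itself. So an
  -- unserved state has colour `p` on all touched groups, and if it has no further group of colour
  -- `p`, the untouched ones have the other colour.
  holds-or-matches : ∀ {r} p (ρ : Vec (Maybe (Fin J)) r) (x : State r) →
    Holds (config x) (page (not p)) (slots p ρ)
    ⊎ (justs ρ ≤ count p x × (count p x ≤ justs ρ → matches p ρ x ≡ 1))
  holds-or-matches p [] [] = inj₂ (z≤n , λ _ → refl)
  holds-or-matches p (just i ∷ ρ) ((q , i′) ∷ w) with escapes p i q i′
  ... | inj₂ (s , s∈ , c≡) =
    inj₁ (_ , ∈-++ˡ (slots p ρ) s∈ , trans (config-↑ˡ (q , i′) w s) (cong (λ b → just (page b)) c≡))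
  ... | inj₁ refl with holds-or-matches p ρ w
  ...   | inj₁ (s , s∈ , c≡) = inj₁ (_ , ∈-++ʳ (block p i) s∈ , trans (config-↑ʳ (q , i′) w s) c≡)
  ...   | inj₂ (lower , exact) rewrite agree-refl p | δ-refl i =
    inj₂ (s≤s lower , λ upper → trans (*-identityˡ _) (exact (s≤s⁻¹ upper)))
  holds-or-matches p (nothing ∷ ρ) ((q , i′) ∷ w) with holds-or-matches p ρ w
  ... | inj₁ (s , s∈ , c≡) = inj₁ (_ , ∈-++ʳ (⊥ {n = j}) s∈ , trans (config-↑ʳ (q , i′) w s) c≡)
  ... | inj₂ (lower , exact) = inj₂ (≤-trans lower (m≤n+m _ (agree p q)) , exact′ p q lower exact)
    where
    exact′ : ∀ p q → justs ρ ≤ count p w → (count p w ≤ justs ρ → matches p ρ w ≡ 1) →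
      agree p q + count p w ≤ justs ρ → agree (not p) q * matches p ρ w ≡ 1
    exact′ true  true  lower exact upper = contradiction (≤-trans upper lower) 1+n≰n
    exact′ true  false lower exact upper = trans (*-identityˡ _) (exact upper)
    exact′ false true  lower exact upper = trans (*-identityˡ _) (exact upper)
    exact′ false false lower exact upper = contradiction (≤-trans upper lower) 1+n≰n

  -- The trap found in each group is stored as a state, so that `count` gives the number of traps of
  -- either colour.
  traps : ∀ {r} → Config (r * j) → State {J} r
  traps {zero}  Γ = []
  traps {suc r} Γ = (proj₁ here-trap , proj₁ (proj₂ here-trap)) ∷ traps (λ s → Γ (j ↑ʳ s))
    where here-trap = trapped (λ s → Γ (s ↑ˡ (r * j)))

  -- The request joins the trap blocks of the first `n` groups whose trap has colour `p`; none of
  -- their slots holds the requested page.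
  spring : ∀ {r} (Γ : Config (r * j)) p n → n ≤ count p (traps {r} Γ) →
    ∃[ ρ ] (justs {J} {r} ρ ≡ n × ¬ Holds Γ (page (not p)) (slots p ρ))
  spring {zero} Γ p .zero z≤n = [] , refl , λ ()
  spring {suc r} Γ p n n≤ with trapped (λ s → Γ (s ↑ˡ (r * j))) | n≤
  ... | q , i , trap | n≤′ = choose p q n n≤′ trap
    where
    Γ′ : Config (r * j)
    Γ′ s = Γ (j ↑ʳ s)
    skip : ∀ p n → n ≤ count p (traps {r} Γ′) → ∃[ ρ ] (justs {J} {suc r} ρ ≡ n × ¬ Holds Γ (page (not p)) (slots p ρ))
    skip p n n≤ with spring {r} Γ′ p n n≤
    ... | ρ , justs≡ , empty = (nothing ∷ ρ) , justs≡ , λ { (s , s∈ , Γ≡) → missing s s∈ Γ≡ }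
      where
      missing : ∀ s → s ∈ (⊥ {n = j} Vec.++ slots p ρ) → Γ s ≢ just (page (not p))
      missing s s∈ Γ≡ with ∈-++⁻ (⊥ {n = j}) s∈
      ... | inj₁ (_ , _ , u∈⊥)    = ∉⊥ u∈⊥
      ... | inj₂ (u , refl , u∈) = empty (u , u∈ , Γ≡)
    take : ∀ p n → n ≤ count p (traps {r} Γ′) → (∀ s → s ∈ block p i → Γ (s ↑ˡ (r * j)) ≢ just (page (not p))) →
      ∃[ ρ ] (justs {J} {suc r} ρ ≡ suc n × ¬ Holds Γ (page (not p)) (slots p ρ))
    take p n n≤ trap with spring {r} Γ′ p n n≤
    ... | ρ , justs≡ , empty = (just i ∷ ρ) , cong suc justs≡ , λ { (s , s∈ , Γ≡) → missing s s∈ Γ≡ }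
      where
      missing : ∀ s → s ∈ (block p i Vec.++ slots p ρ) → Γ s ≢ just (page (not p))
      missing s s∈ Γ≡ with ∈-++⁻ (block p i) s∈
      ... | inj₁ (u , refl , u∈) = trap u u∈ Γ≡
      ... | inj₂ (u , refl , u∈) = empty (u , u∈ , Γ≡)
    choose : ∀ p q n → n ≤ agree p q + count p (traps {r} Γ′) →
      (∀ s → s ∈ block q i → Γ (s ↑ˡ (r * j)) ≢ just (page (not q))) →
      ∃[ ρ ] (justs {J} {suc r} ρ ≡ n × ¬ Holds Γ (page (not p)) (slots p ρ))
    choose p     q     zero    _  _    = skip p zero z≤n
    choose true  true  (suc n) n≤ trap = take true n (s≤s⁻¹ n≤) trap
    choose true  false (suc n) n≤ _    = skip true (suc n) n≤
    choose false true  (suc n) n≤ _    = skip false (suc n) n≤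
    choose false false (suc n) n≤ trap = take false n (s≤s⁻¹ n≤) trap

  module _ (n : ℕ) where

    private
      r : ℕ
      r = suc (2 * n)

    at : State {J} r → Bool → State r
    at x true  = x
    at x false = partner x

    -- `at x p` is the member of the pair with majority colour `p`: of 2n+1 groups, `x` has n+1 of
    -- colour `true`, and `partner` turns exactly one of them to `false`.
    count-at : ∀ x → count true x ≡ suc n → ∀ p → count p (at x p) ≡ suc n × count p (at x (not p)) ≡ n
    count-at x ct p = by p
      where
      n+n : suc n + n ≡ r
      n+n = cong (λ u → suc (n + u)) (sym (+-identityʳ n))
      other : ∀ {a b a′ b′} → a + b ≡ r → a ≡ a′ → a′ + b′ ≡ r → b ≡ b′
      other {a} sum≡ refl sum≡′ = +-cancelˡ-≡ a _ _ (trans sum≡ (sym sum≡′))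
      cf : count false x ≡ n
      cf = other (count-true+false x) ct n+n
      1≤height : 1 ≤ height x
      1≤height = +-cancelˡ-≤ n 1 (height x) (begin
        n + 1                   ≡⟨ +-comm n 1 ⟩
        suc n                   ≡⟨ ct ⟨
        count true x            ≤⟨ count-true≤count-false+height x ⟩
        count false x + height x ≡⟨ cong (_+ height x) cf ⟩
        n + height x            ∎)
        where open ≤-Reasoning
      ct′ : count true (partner x) ≡ n
      ct′ = suc-injective (trans (count-true-partner x 1≤height) ct)
      by : ∀ p → count p (at x p) ≡ suc n × count p (at x (not p)) ≡ n
      by true  = ct , ct′
      by false = other (count-true+false (partner x)) ct′ (trans (+-comm n (suc n)) n+n) , cf

    -- The states in the pool have a surplus of `true`, hence positive height, so that `∑-partner`
    -- applies to them.
    weight≤positive? : ∀ (x : State {J} r) → δℕ (count true x) (suc n) ≤ positive? (height x)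
    weight≤positive? x with height x in h≡
    ... | suc _ = δℕ≤1 (count true x) (suc n)
    ... | zero with δℕ (count true x) (suc n) in d≡
    ...   | zero  = z≤n
    ...   | suc _ = contradiction absurd 1+n≰n
      where
      ct : count true x ≡ suc n
      ct = δℕ≢0⇒≡ (count true x) (suc n) (λ d≡0 → contradiction (trans (sym d≡) d≡0) λ ())
      absurd : suc n ≤ n
      absurd = begin
        suc n                      ≡⟨ ct ⟨
        count true x               ≤⟨ count-true≤count-false+height x ⟩
        count false x + height x   ≡⟨ cong₂ _+_ (proj₂ (count-at x ct false)) h≡ ⟩
        n + 0                      ≡⟨ +-identityʳ n ⟩
        n                          ∎
        where open ≤-Reasoning

    GroupRequest : Set
    GroupRequest = Bool × (∃[ ρ ] justs {J} {r} ρ ≡ suc n)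

    toRequest : GroupRequest → Request (r * j) (OneOutOf (r * j) (suc n * t))
    toRequest (p , ρ , justs≡) = page (not p) , slots p ρ , trans (∣slots∣ p ρ) (cong (_* t) justs≡)

    hits : State {J} r → GroupRequest → ℕ
    hits x (p , ρ , _) = matches p ρ (at x p)

    -- For `p = true` the pool states are counted directly. For `p = false` their partners are, and
    -- the injectivity in `∑-partner` keeps a state from being counted twice.
    hits≤ : ∀ ρ → ∑[ x ∈ states r ] (δℕ (count true x) (suc n) * hits x ρ) ≤ J ^ n
    hits≤ (p , ρ , justs≡) = begin
      ∑[ x ∈ states r ] (δℕ (count true x) (suc n) * matches p ρ (at x p)) ≤⟨ reindex p ⟩
      ∑ (states r) (matches p ρ)                                          ≡⟨ number-of-matches p ρ ⟩
      J ^ nothings ρ                                                      ≡⟨ cong (J ^_) nothings≡n ⟩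
      J ^ n                                                               ∎
      where
      open ≤-Reasoning
      nothings≡n : nothings ρ ≡ n
      nothings≡n = +-cancelˡ-≡ (suc n) _ _ (trans (cong (_+ nothings ρ) (sym justs≡))
        (trans (justs+nothings ρ) (cong (λ u → suc (n + u)) (+-identityʳ n))))
      reindex : ∀ p → ∑[ x ∈ states r ] (δℕ (count true x) (suc n) * matches p ρ (at x p)) ≤ ∑ (states r) (matches p ρ)
      reindex true  = ∑-mono (states {J} r) (λ x →
        ≤-trans (*-monoˡ-≤ (matches true ρ x) (δℕ≤1 (count true x) (suc n))) (≤-reflexive (*-identityˡ (matches true ρ x))))
      reindex false = ≤-trans (∑-mono (states {J} r) (λ x → *-monoˡ-≤ (matches false ρ (partner x)) (weight≤positive? x))) (∑-partner r (matches false ρ))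

    -- The member of the pair with only n groups of colour `p` cannot be missed, as the request has
    -- n+1 blocks. So whenever the other member is missed, a move repairs it.
    serves : ∀ x → δℕ (count true x) (suc n) ≢ 0 → ∀ ρ b → Satisfies (config (at x b)) (toRequest ρ)
      ⊎ (1 ≤ hits x ρ × Satisfies (config (at x (not b))) (toRequest ρ))
    serves x w≢0 (p , ρ , justs≡) b = by p b at-p at-not-p
      where
      counts = count-at x (δℕ≢0⇒≡ (count true x) (suc n) w≢0) p
      Served : Bool → Set
      Served b = Holds (config (at x b)) (page (not p)) (slots p ρ)
      at-p : Served p ⊎ 1 ≤ matches p ρ (at x p)
      at-p with holds-or-matches p ρ (at x p)
      ... | inj₁ holds       = inj₁ holds
      ... | inj₂ (_ , exact) = inj₂ (≤-reflexive (sym (exact (≤-reflexive (trans (proj₁ counts) (sym justs≡))))))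
      at-not-p : Served (not p)
      at-not-p with holds-or-matches p ρ (at x (not p))
      ... | inj₁ holds       = holds
      ... | inj₂ (lower , _) = contradiction (subst (suc n ≤_) (proj₂ counts) (subst (_≤ _) justs≡ lower)) 1+n≰n
      by : ∀ q b → Served q ⊎ 1 ≤ matches p ρ (at x p) → Served (not q) →
        Served b ⊎ (1 ≤ matches p ρ (at x p) × Served (not b))
      by true  false _ sat = inj₁ sat
      by false true  _ sat = inj₁ sat
      by true  true  (inj₁ sat)    _   = inj₁ sat
      by true  true  (inj₂ struck) sat = inj₂ (struck , sat)
      by false false (inj₁ sat)    _   = inj₁ sat
      by false false (inj₂ struck) sat = inj₂ (struck , sat)

    -- Majority: among 2n+1 traps some n+1 have the same colour.
    defeats : ∀ (Γ : Config (r * j)) → ∃[ ρ ] ¬ Satisfies Γ (toRequest ρ)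
    defeats Γ with suc n ≤? count true (traps {r} Γ)
    ... | yes n≤ = let ρ , justs≡ , unsat = spring {r} Γ true (suc n) n≤ in (true , ρ , justs≡) , unsat
    ... | no n≰ = let ρ , justs≡ , unsat = spring {r} Γ false (suc n) many-false in (false , ρ , justs≡) , unsat
      where
      many-false : suc n ≤ count false (traps {r} Γ)
      many-false = +-cancelˡ-≤ n (suc n) _ (begin
        n + suc n                                          ≡⟨ +-suc n n ⟩
        suc (n + n)                                        ≡⟨ cong (λ u → suc (n + u)) (+-identityʳ n) ⟨
        r                                                  ≡⟨ count-true+false (traps {r} Γ) ⟨
        count true (traps {r} Γ) + count false (traps {r} Γ) ≤⟨ +-monoˡ-≤ _ (s≤s⁻¹ (≰⇒> n≰)) ⟩
        n + count false (traps {r} Γ)                      ∎)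
        where open ≤-Reasoning

    adversary : Adversary (r * j) (suc n * t) ((r C suc n) * J ^ r) (J ^ n)
    adversary = record
      { Index = State {J} r
      ; indices = states r
      ; weight = λ x → δℕ (count true x) (suc n)
      ; total = number-of-states {J} r (suc n)
      ; conf = λ x b → config (at x b)
      ; conf-near = λ { x true → near-cost (near-partner x) ; x false → near-cost (near-sym (near-partner x)) }
      ; Req = GroupRequest
      ; request = toRequest
      ; hit = hits
      ; hits-bounded = hits≤
      ; served = serves
      ; defeat = defeats
      }

-- Single slots and odd cycles

-- Reads any slot content as a colour. An empty slot or a third page counts as `false`, which is
-- harmless: only the absence of page 1 is inferred from it.
isOne : Maybe ℕ → Bool
isOne (just 1) = true
isOne _        = false

isOne-page : ∀ p → isOne (just (page p)) ≡ p
isOne-page true  = refl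
isOne-page false = refl

isOne≡p⇒≢page : ∀ x p → isOne x ≡ p → x ≢ just (page (not p))
isOne≡p⇒≢page x p isOne≡ refl = not-¬ refl (sym (trans (sym (isOne-page (not p))) isOne≡))

singleSlot : Gadget 1 1 1
singleSlot = record
  { colour = λ p _ _ → p
  ; block = λ _ _ → ⁅ zero ⁆
  ; block-size = λ _ _ → refl
  ; colour-near = λ { zero → zero , λ { zero 0≢0 → contradiction refl 0≢0 } }
  ; escapes = escapes
  ; trapped = λ Γ → isOne (Γ zero) , zero , λ { zero _ → isOne≡p⇒≢page (Γ zero) _ refl }
  }
  where
  escapes : ∀ p (i : Fin 1) q (i′ : Fin 1) → ((q , i′) ≡ (p , i)) ⊎ (∃[ s ] (s ∈ ⁅ zero ⁆ × q ≡ not p))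
  escapes p zero q zero with q Bool.≟ p
  ... | yes refl = inj₁ refl
  ... | no  q≢p  = inj₂ (zero , x∈⁅x⁆ {1} zero , ¬-not q≢p)

∣⁅a⁆∪⁅b⁆∣≡2 : ∀ {n} (a b : Fin n) → a ≢ b → ∣ ⁅ a ⁆ ∪ ⁅ b ⁆ ∣ ≡ 2
∣⁅a⁆∪⁅b⁆∣≡2 zero    zero    a≢b = contradiction refl a≢b
∣⁅a⁆∪⁅b⁆∣≡2 zero    (suc b) a≢b = cong suc (trans (cong ∣_∣ (∪-identityˡ ⁅ b ⁆)) (∣⁅x⁆∣≡1 b))
∣⁅a⁆∪⁅b⁆∣≡2 (suc a) zero    a≢b = cong suc (trans (cong ∣_∣ (∪-identityʳ ⁅ a ⁆)) (∣⁅x⁆∣≡1 a))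
∣⁅a⁆∪⁅b⁆∣≡2 (suc a) (suc b) a≢b = ∣⁅a⁆∪⁅b⁆∣≡2 a b λ { refl → a≢b refl }

odd? : ℕ → Bool
odd? zero    = false
odd? (suc n) = not (odd? n)

odd?-2* : ∀ n → odd? (2 * n) ≡ false
odd?-2* zero    = refl
odd?-2* (suc n) rewrite +-suc n (n + 0) = trans (not-involutive _) (odd?-2* n)

next : ∀ {l} → Fin (suc l) → Fin (suc l)
next e with view e
... | ‵fromℕ     = zero
... | ‵inject₁ s = suc s

prev : ∀ {l} → Fin (suc l) → Fin (suc l)
prev zero    = fromℕ _
prev (suc s) = inject₁ s

next-prev : ∀ {l} (i : Fin (suc l)) → next (prev i) ≡ i
next-prev {l} zero rewrite view-fromℕ l = refl
next-prev (suc s) rewrite view-inject₁ s = refl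

prev-next : ∀ {l} (e : Fin (suc l)) → prev (next e) ≡ e
prev-next e with view e
... | ‵fromℕ     = refl
... | ‵inject₁ s = refl

prev≢ : ∀ {l} (i : Fin (suc (suc l))) → prev i ≢ i
prev≢ zero    ()
prev≢ (suc s) eq = inject₁≢suc s eq
  where
  inject₁≢suc : ∀ {l} (s : Fin l) → inject₁ s ≢ suc s
  inject₁≢suc (suc s) eq with inject₁ s in eq′
  inject₁≢suc (suc s) refl | .(suc s) = inject₁≢suc s eq′

-- Slot i has colour p.  Starting from slot i + 1 and going around the odd cycle the other slots
-- alternate true, false, …, false, so that p decides which of the edges (i, i + 1), (i - 1, i) is monochromatic.
cycleColour : ∀ {n} → Bool → Fin n → Fin n → Bool
cycleColour p zero    zero    = p
cycleColour p zero    (suc s) = not (odd? (toℕ s))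
cycleColour p (suc i) zero    = odd? (toℕ i)
cycleColour p (suc i) (suc s) = cycleColour p i s

cycleColour-near : ∀ {n} (i s : Fin n) → s ≢ i → cycleColour true i s ≡ cycleColour false i s
cycleColour-near zero    zero    s≢i = contradiction refl s≢i
cycleColour-near zero    (suc s) s≢i = refl
cycleColour-near (suc i) zero    s≢i = refl
cycleColour-near (suc i) (suc s) s≢i = cycleColour-near i s λ { refl → s≢i refl }

-- An edge away from slot `i` has two colours. The slot after `i` is always `true` and the slot
-- before it always `false`, so of the two edges at `i` exactly one is monochromatic, depending on
-- `q`.
data EdgeColours {l} (q : Bool) (i : Fin (suc l)) (e e′ : Fin (suc l)) : Set where
  distinct : cycleColour q i e′ ≡ not (cycleColour q i e) → EdgeColours q i e e′
  source   : i ≡ e  → cycleColour q i e ≡ q → cycleColour q i e′ ≡ true → EdgeColours q i e e′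
  target   : i ≡ e′ → cycleColour q i e ≡ false → cycleColour q i e′ ≡ q → EdgeColours q i e e′

inner-edge : ∀ {l} q (i : Fin (suc l)) (s : Fin l) → EdgeColours q i (inject₁ s) (suc s)
inner-edge q zero zero = source refl refl refl
inner-edge q zero (suc s) = distinct (cong (λ n → not (not (odd? n))) (sym (toℕ-inject₁ s)))
inner-edge q (suc zero) zero = target refl refl refl
inner-edge q (suc (suc i)) zero = distinct (sym (not-involutive _))
inner-edge q (suc i) (suc s) with inner-edge q i s
... | distinct b≡    = distinct b≡
... | source i≡ a≡ b≡ = source (cong suc i≡) a≡ b≡
... | target i≡ a≡ b≡ = target (cong suc i≡) a≡ b≡

-- After slot `i` the colours alternate, beginning with `true`, so the parity of the distance
-- decides.
last-colour : ∀ l q (i : Fin (suc l)) → (i ≡ fromℕ l × cycleColour q i (fromℕ l) ≡ q)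
  ⊎ cycleColour q i (fromℕ l) ≡ odd? l xor odd? (toℕ i)
last-colour zero    q zero    = inj₁ (refl , refl)
last-colour (suc l) q zero    = inj₂ (trans (cong (λ n → not (odd? n)) (toℕ-fromℕ l)) (sym (xor-identityʳ _)))
last-colour (suc l) q (suc i) with last-colour l q i
... | inj₁ (i≡ , a≡) = inj₁ (cong suc i≡ , a≡)
... | inj₂ a≡        = inj₂ (trans a≡ (not-xor-not (odd? l) (odd? (toℕ i))))
  where
  not-xor-not : ∀ a b → a xor b ≡ not a xor not b
  not-xor-not true  true  = refl
  not-xor-not true  false = refl
  not-xor-not false b     = sym (not-involutive b)

-- The last slot has an even number, as the cycle is odd, and this makes the alternation fit
-- together across the edge back to slot 0.
wrap-edge : ∀ {l} → odd? (suc l) ≡ false → ∀ q (i : Fin (suc (suc l))) → EdgeColours q i (fromℕ (suc l)) zero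
wrap-edge {l} even q zero with last-colour (suc l) q zero
... | inj₂ a≡ = target refl (trans a≡ (trans (xor-identityʳ _) even)) refl
wrap-edge {l} even q (suc i) with last-colour (suc l) q (suc i)
... | inj₁ (refl , a≡) = source refl a≡ (trans (cong odd? (toℕ-fromℕ l)) (trans (sym (not-involutive _)) (cong not even)))
... | inj₂ a≡ = distinct (sym (trans (cong not (trans a≡ (cong (_xor odd? (toℕ (suc i))) even))) (not-involutive _)))

edge-colours : ∀ {l} → odd? (suc l) ≡ false → ∀ q (i i′ : Fin (suc (suc l))) → EdgeColours q i (prev i′) i′
edge-colours even q i zero    = wrap-edge even q i
edge-colours even q i (suc s) = inner-edge q i s

-- If no two neighbours agree, the colours alternate along the path and the parity of its length
-- relates the ends.
search-inner : ∀ l (a : Fin (suc l) → Bool) →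
  (∃[ s ] a (inject₁ s) ≡ a (suc s)) ⊎ a (fromℕ l) ≡ a zero xor odd? l
search-inner zero a = inj₂ (sym (xor-identityʳ _))
search-inner (suc l) a with a zero Bool.≟ a (suc zero)
... | yes same = inj₁ (zero , same)
... | no  differ with search-inner l (λ s → a (suc s))
...   | inj₁ (s , same) = inj₁ (suc s , same)
...   | inj₂ last≡ = inj₂ (trans last≡ (trans (cong (_xor odd? l) (¬-not (λ eq → differ (sym eq)))) (move (a zero) (odd? l))))
  where
  move : ∀ a b → not a xor b ≡ a xor not b
  move true  b = sym (not-involutive b)
  move false b = refl

-- An alternating path with an even number of edges has equal ends, so then the closing edge is
-- monochromatic.
monochromatic-edge : ∀ {l} → odd? l ≡ false → ∀ (a : Fin (suc l) → Bool) → ∃[ i ] a (prev i) ≡ a i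
monochromatic-edge {l} even a with search-inner l a
... | inj₁ (s , same) = suc s , same
... | inj₂ last≡      = zero , trans last≡ (trans (cong (a zero xor_) even) (xor-identityʳ _))

cycle : ∀ l → odd? (suc l) ≡ false → Gadget (suc (suc l)) (suc (suc l)) 2
cycle l even = record
  { colour = cycleColour
  ; block = block
  ; block-size = block-size
  ; colour-near = λ i → i , cycleColour-near i
  ; escapes = escapes
  ; trapped = trapped
  }
  where
  Slot = Fin (suc (suc l))
  block : Bool → Slot → Subset (suc (suc l))
  -- Each edge serves as a block for both pages: it is named by its first slot for colour `true` and
  -- by its second slot for `false`, matching the edge that `cycleColour` makes monochromatic.
  block true  i = ⁅ i ⁆ ∪ ⁅ next i ⁆
  block false i = ⁅ prev i ⁆ ∪ ⁅ i ⁆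
  block-size : ∀ p i → ∣ block p i ∣ ≡ 2
  block-size true  i = ∣⁅a⁆∪⁅b⁆∣≡2 i (next i) (λ i≡ → prev≢ (next i) (trans (prev-next i) i≡))
  block-size false i = ∣⁅a⁆∪⁅b⁆∣≡2 (prev i) i (prev≢ i)
  left : ∀ (a b : Slot) → a ∈ (⁅ a ⁆ ∪ ⁅ b ⁆)
  left a b = x∈p∪q⁺ (inj₁ (x∈⁅x⁆ a))
  right : ∀ (a b : Slot) → b ∈ (⁅ a ⁆ ∪ ⁅ b ⁆)
  right a b = x∈p∪q⁺ (inj₂ (x∈⁅x⁆ b))
  one-of : ∀ q i {a b : Slot} → cycleColour q i b ≡ not (cycleColour q i a) → ∀ p →
    ∃[ s ] (s ∈ (⁅ a ⁆ ∪ ⁅ b ⁆) × cycleColour q i s ≡ p)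
  one-of q i {a} {b} b≡ p with cycleColour q i a Bool.≟ p
  ... | yes a≡p = a , left a b , a≡p
  ... | no  a≢p = b , right a b , trans b≡ (sym (¬-not (λ eq → a≢p (sym eq))))
  escapes : ∀ p i q i′ → ((q , i′) ≡ (p , i)) ⊎ (∃[ s ] (s ∈ block p i × cycleColour q i′ s ≡ not p))
  escapes true i q i′ with subst (λ e → EdgeColours q i′ e (next i)) (prev-next i) (edge-colours even q i′ (next i))
  ... | distinct b≡    = inj₂ (one-of q i′ b≡ false)
  ... | target _ a≡ _  = inj₂ (i , left i (next i) , a≡)
  escapes true i true  i′ | source refl _ _  = inj₁ refl
  escapes true i false i′ | source refl a≡ _ = inj₂ (i , left i (next i) , a≡)
  escapes false i q i′ with edge-colours even q i′ i
  ... | distinct b≡    = inj₂ (one-of q i′ b≡ true)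
  ... | source _ _ b≡  = inj₂ (i , right (prev i) i , b≡)
  escapes false i true  i′ | target refl _ b≡ = inj₂ (i , right (prev i) i , b≡)
  escapes false i false i′ | target refl _ _  = inj₁ refl
  trapped : ∀ (Γ : Config (suc (suc l))) → ∃[ p ] ∃[ i ] (∀ s → s ∈ block p i → Γ s ≢ just (page (not p)))
  trapped Γ with monochromatic-edge even (λ s → isOne (Γ s))
  ... | i , same with isOne (Γ i) in Γi≡
  ...   | true  = true , prev i , avoid
    where
    avoid : ∀ s → s ∈ (⁅ prev i ⁆ ∪ ⁅ next (prev i) ⁆) → Γ s ≢ just (page false)
    avoid s s∈ with x∈p∪q⁻ ⁅ prev i ⁆ ⁅ next (prev i) ⁆ s∈
    ... | inj₁ s∈a rewrite x∈⁅y⁆⇒x≡y (prev i) s∈a = isOne≡p⇒≢page _ true same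
    ... | inj₂ s∈b rewrite x∈⁅y⁆⇒x≡y (next (prev i)) s∈b | next-prev i = isOne≡p⇒≢page _ true Γi≡
  ...   | false = false , i , avoid
    where
    avoid : ∀ s → s ∈ (⁅ prev i ⁆ ∪ ⁅ i ⁆) → Γ s ≢ just (page true)
    avoid s s∈ with x∈p∪q⁻ ⁅ prev i ⁆ ⁅ i ⁆ s∈
    ... | inj₁ s∈a rewrite x∈⁅y⁆⇒x≡y (prev i) s∈a = isOne≡p⇒≢page _ false same
    ... | inj₂ s∈b rewrite x∈⁅y⁆⇒x≡y i s∈b = isOne≡p⇒≢page _ false Γi≡

-- The two bounds and their growth

midBinom≢0 : ∀ n → midBinom n ≢ 0
midBinom≢0 n c≡0 = contradiction
  (≤-trans (m^n>0 16 n) (≤-trans (midBinom-lower n) (≤-reflexive (cong (λ c → c * c * suc n) c≡0))))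
  λ ()

groups-bound : ∀ {j J t} → Gadget j J t → .{{_ : NonZero J}} → ∀ n →
  OptRatioAtLeast (suc (2 * n) * j) (OneOutOf (suc (2 * n) * j) (suc n * t)) (ℕ→ℚ (midBinom n * J ^ suc n))
groups-bound {j} {J} {t} 𝒢 n = adversary⇒lowerBound (Construction.adversary 𝒢 n) N≢0 {{m^n≢0 J n}} _
  (trans (sym (ℕ→ℚ-* (midBinom n * J ^ suc n) (J ^ n))) (cong ℕ→ℚ N≡))
  where
  N≢0 : midBinom n * J ^ suc (2 * n) ≢ 0
  N≢0 N≡0 with m*n≡0⇒m≡0∨n≡0 (midBinom n) N≡0
  ... | inj₁ c≡0 = midBinom≢0 n c≡0
  ... | inj₂ J≡0 = ℕ.≢-nonZero⁻¹ (J ^ suc (2 * n)) {{m^n≢0 J (suc (2 * n))}} J≡0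
  N≡ : midBinom n * J ^ suc n * J ^ n ≡ midBinom n * J ^ suc (2 * n)
  N≡ = trans (*-assoc (midBinom n) (J ^ suc n) (J ^ n))
    (cong (midBinom n *_) (trans (sym (^-distribˡ-+-* J (suc n) n)) (cong (λ u → J ^ suc (n + u)) (sym (+-identityʳ n)))))

middle-adversary : ∀ n → Adversary (suc (2 * n)) (suc n) (midBinom n) 1
middle-adversary n = cast (*-identityʳ _) (*-identityʳ _)
  (trans (cong (midBinom n *_) (^-zeroˡ (suc (2 * n)))) (*-identityʳ _)) (^-zeroˡ n)
  (Construction.adversary singleSlot n)
  where
  cast : ∀ {k k′ m m′ N N′ h h′} → k ≡ k′ → m ≡ m′ → N ≡ N′ → h ≡ h′ → Adversary k m N h → Adversary k′ m′ N′ h′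
  cast refl refl refl refl 𝒜 = 𝒜

odd-bound : ∀ n → OptRatioAtLeast (suc (2 * n)) (OneOutOf (suc (2 * n)) (suc n)) (ℕ→ℚ (midBinom n))
odd-bound n = adversary⇒lowerBound (middle-adversary n) (midBinom≢0 n) _ (ℚₚ.*-identityʳ _)

even-bound : ∀ n → OptRatioAtLeast (suc (suc (2 * n))) (OneOutOf (suc (suc (2 * n))) (suc n)) (ℕ→ℚ (midBinom n))
even-bound n = adversary⇒lowerBound (unusedSlot (middle-adversary n)) (midBinom≢0 n) _ (ℚₚ.*-identityʳ _)

2*[1+n]/2≡1+n : ∀ n → 2 * suc n / 2 ≡ suc n
2*[1+n]/2≡1+n n = trans (cong (_/ 2) (*-comm 2 (suc n))) (m*n/n≡m (suc n) 2)

[1+2n+1]/2≡1+n : ∀ n → (suc (2 * n) + 1) / 2 ≡ suc n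
[1+2n+1]/2≡1+n n = trans (cong (_/ 2) (regroup n)) (m*n/n≡m (suc n) 2)
  where
  regroup : ∀ n → suc (2 * n) + 1 ≡ suc n * 2
  regroup = solve-∀

[2+2n+1]/2≡1+n : ∀ n → (suc (suc (2 * n)) + 1) / 2 ≡ suc n
[2+2n+1]/2≡1+n n = trans (cong (_/ 2) (regroup n)) (trans (+-distrib-/-∣ʳ 1 (n∣m*n (suc n) {2})) (m*n/n≡m (suc n) 2))
  where
  regroup : ∀ n → suc (suc (2 * n)) + 1 ≡ 1 + suc n * 2
  regroup = solve-∀

parity : ∀ k .{{_ : NonZero k}} → (∃[ n ] k ≡ suc (2 * n)) ⊎ (∃[ n ] k ≡ suc (suc (2 * n)))
parity (suc zero) = inj₁ (0 , refl)
parity (suc (suc k)) with parity (suc k)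
... | inj₁ (n , refl) = inj₂ (n , refl)
... | inj₂ (n , refl) = inj₁ (suc n , cong (λ u → suc (suc u)) (sym (+-suc n (n + 0))))

-- Growth of the bound of part (i)

eighth : ℚ
eighth = ℤ.+ 1 ℚ./ 8

eighth-≤ : ∀ a b → a ≤ 8 * b → eighth ℚ.* ℕ→ℚ a ℚ.≤ ℕ→ℚ b
eighth-≤ a b a≤8b = begin
  eighth ℚ.* ℕ→ℚ a                ≤⟨ ℚₚ.*-monoˡ-≤-nonNeg eighth (ℕ→ℚ-mono-≤ a≤8b) ⟩
  eighth ℚ.* ℕ→ℚ (8 * b)          ≡⟨ cong (eighth ℚ.*_) (ℕ→ℚ-* 8 b) ⟩
  eighth ℚ.* (ℕ→ℚ 8 ℚ.* ℕ→ℚ b)    ≡⟨ ℚₚ.*-assoc eighth (ℕ→ℚ 8) (ℕ→ℚ b) ⟨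
  1ℚ ℚ.* ℕ→ℚ b                    ≡⟨ ℚₚ.*-identityˡ (ℕ→ℚ b) ⟩
  ℕ→ℚ b                           ∎
  where open ℚₚ.≤-Reasoning

0<eighth : 0ℚ ℚ.< eighth
0<eighth = ℚₚ.positive⁻¹ eighth

-- The estimate `L` ≥ 2^k / √(8k) in squared form, equivalent because `L` is not negative. The 8
-- comes from k = 2n+2, where 16(n+1) = 8k.
middle-asymptotics : ∀ k .{{_ : NonZero k}} → ∃[ L ] (0ℚ ℚ.≤ L
  × eighth ℚ.* ℕ→ℚ (2 ^ k) ℚ.* ℕ→ℚ (2 ^ k) ℚ.≤ L ℚ.* L ℚ.* ℕ→ℚ k
  × OptRatioAtLeast k (OneOutOf k ((k + 1) / 2)) L)
middle-asymptotics k = by (parity k)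
  where
  16^n≡ : ∀ n → 2 ^ (2 * n) * 2 ^ (2 * n) ≡ 16 ^ n
  16^n≡ n = trans (sym (cong₂ _*_ (^-*-assoc 2 2 n) (^-*-assoc 2 2 n))) (sym (^-distribʳ-* 4 4 n))
  toℚ : ∀ a b c → a * a ≤ 8 * (b * b * c) → eighth ℚ.* ℕ→ℚ a ℚ.* ℕ→ℚ a ℚ.≤ ℕ→ℚ b ℚ.* ℕ→ℚ b ℚ.* ℕ→ℚ c
  toℚ a b c a²≤ = subst₂ ℚ._≤_
    (trans (cong (eighth ℚ.*_) (ℕ→ℚ-* a a)) (sym (ℚₚ.*-assoc eighth (ℕ→ℚ a) (ℕ→ℚ a))))
    (trans (ℕ→ℚ-* (b * b) c) (cong (ℚ._* ℕ→ℚ c) (ℕ→ℚ-* b b)))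
    (eighth-≤ (a * a) (b * b * c) a²≤)
  by : (∃[ n ] k ≡ suc (2 * n)) ⊎ (∃[ n ] k ≡ suc (suc (2 * n))) → ∃[ L ] (0ℚ ℚ.≤ L
    × eighth ℚ.* ℕ→ℚ (2 ^ k) ℚ.* ℕ→ℚ (2 ^ k) ℚ.≤ L ℚ.* L ℚ.* ℕ→ℚ k
    × OptRatioAtLeast k (OneOutOf k ((k + 1) / 2)) L)
  by (inj₁ (n , refl)) = ℕ→ℚ c , ℚₚ.nonNegative⁻¹ (ℕ→ℚ c) {{ℕ→ℚ-nonNeg c}} , toℚ (2 ^ suc (2 * n)) c (suc (2 * n)) (begin
      2 ^ suc (2 * n) * 2 ^ suc (2 * n)          ≡⟨ regroup (2 ^ (2 * n)) ⟩
      4 * (2 ^ (2 * n) * 2 ^ (2 * n))            ≡⟨ cong (4 *_) (16^n≡ n) ⟩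
      4 * 16 ^ n                                 ≤⟨ *-monoʳ-≤ 4 (midBinom-lower n) ⟩
      4 * (c * c * suc n)                        ≤⟨ m≤m+n _ (4 * (c * c) * suc (3 * n)) ⟩
      4 * (c * c * suc n) + 4 * (c * c) * suc (3 * n) ≡⟨ regroup′ (c * c) n ⟩
      8 * (c * c * suc (2 * n))                  ∎)
    , subst (λ m → OptRatioAtLeast (suc (2 * n)) (OneOutOf (suc (2 * n)) m) (ℕ→ℚ c)) (sym ([1+2n+1]/2≡1+n n)) (odd-bound n)
    where
    open ≤-Reasoning
    c = midBinom n
    regroup : ∀ x → (2 * x) * (2 * x) ≡ 4 * (x * x)
    regroup = solve-∀
    regroup′ : ∀ x n → 4 * (x * suc n) + 4 * x * suc (3 * n) ≡ 8 * (x * suc (2 * n))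
    regroup′ = solve-∀
  -- For k = 2n+2 the request size is still n+1, so the adversary for 2n+1 slots is reused with one
  -- idle slot.
  by (inj₂ (n , refl)) = ℕ→ℚ c , ℚₚ.nonNegative⁻¹ (ℕ→ℚ c) {{ℕ→ℚ-nonNeg c}} , toℚ (2 ^ suc (suc (2 * n))) c (suc (suc (2 * n))) (begin
      2 ^ suc (suc (2 * n)) * 2 ^ suc (suc (2 * n)) ≡⟨ regroup (2 ^ (2 * n)) ⟩
      16 * (2 ^ (2 * n) * 2 ^ (2 * n))           ≡⟨ cong (16 *_) (16^n≡ n) ⟩
      16 * 16 ^ n                                ≤⟨ *-monoʳ-≤ 16 (midBinom-lower n) ⟩
      16 * (c * c * suc n)                       ≡⟨ regroup′ (c * c) n ⟩
      8 * (c * c * suc (suc (2 * n)))            ∎)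
    , subst (λ m → OptRatioAtLeast (suc (suc (2 * n))) (OneOutOf (suc (suc (2 * n))) m) (ℕ→ℚ c)) (sym ([2+2n+1]/2≡1+n n)) (even-bound n)
    where
    open ≤-Reasoning
    c = midBinom n
    regroup : ∀ x → (2 * (2 * x)) * (2 * (2 * x)) ≡ 16 * (x * x)
    regroup = solve-∀
    regroup′ : ∀ x n → 16 * (x * suc n) ≡ 8 * (x * suc (suc (2 * n)))
    regroup′ = solve-∀

bound : ℕ → ℕ → ℚ
bound m k = ℕ→ℚ ((m ∸ 1) C (m / 2)) ℚ.* ((k ÷ℕ (m ∸ 1)) ^ℚ (m / 2))

j*d÷d≡j : ∀ j d → (j * suc d) ÷ℕ suc d ≡ ℕ→ℚ j
j*d÷d≡j j d = ℚₚ.fromℚᵘ-cong {ℚᵘ.mkℚᵘ (ℤ.+ (j * suc d)) d} {ℚᵘ.mkℚᵘ (ℤ.+ j) 0}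
  (ℚᵘ.*≡* (trans (ℤₚ.*-identityʳ _) (ℤₚ.pos-* j (suc d))))

2*[1+n]∸1≡1+2n : ∀ n → 2 * suc n ∸ 1 ≡ suc (2 * n)
2*[1+n]∸1≡1+2n n = +-suc n (n + 0)

bound≡ : ∀ n j → bound (2 * suc n) (j * suc (2 * n)) ≡ ℕ→ℚ (midBinom n * j ^ suc n)
bound≡ n j = begin
  bound (2 * suc n) (j * suc (2 * n))
    ≡⟨ cong₂ (λ r h → ℕ→ℚ (r C h) ℚ.* (((j * suc (2 * n)) ÷ℕ r) ^ℚ h)) (2*[1+n]∸1≡1+2n n) (2*[1+n]/2≡1+n n) ⟩
  ℕ→ℚ (midBinom n) ℚ.* (((j * suc (2 * n)) ÷ℕ suc (2 * n)) ^ℚ suc n)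
    ≡⟨ cong (λ q → ℕ→ℚ (midBinom n) ℚ.* (q ^ℚ suc n)) (j*d÷d≡j j (2 * n)) ⟩
  ℕ→ℚ (midBinom n) ℚ.* (ℕ→ℚ j ^ℚ suc n)
    ≡⟨ cong (ℕ→ℚ (midBinom n) ℚ.*_) (ℕ→ℚ-^ j (suc n)) ⟨
  ℕ→ℚ (midBinom n) ℚ.* ℕ→ℚ (j ^ suc n)
    ≡⟨ ℕ→ℚ-* (midBinom n) (j ^ suc n) ⟨
  ℕ→ℚ (midBinom n * j ^ suc n) ∎
  where open ≡-Reasoning

Parameters : ℕ → ℕ → Set
Parameters m k = ∃[ n ] ∃[ u ] (m ≡ 2 * suc n × k ≡ suc (2 * suc u) * suc (2 * n))

-- The multiplier cannot be 1, since k would be m - 1; so it is at least 3, the length of a genuine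
-- odd cycle.
parameters : ∀ m k → Even m → 2 ≤ m → m < k → (∃[ j ] (Odd j × k ≡ j * (m ∸ 1))) → Parameters m k
parameters .0 k (zero , refl) () m<k _
parameters m k (suc n , refl) 2≤m m<k (.1 , (zero , refl) , refl) =
  contradiction (≤-trans m<k (≤-trans (≤-reflexive (*-identityˡ (m ∸ 1))) (m∸n≤m m 1))) 1+n≰n
parameters m k (suc n , refl) 2≤m m<k (j , (suc u , refl) , refl) =
  n , u , refl , cong (suc (2 * suc u) *_) (2*[1+n]∸1≡1+2n n)

-- There are m - 1 = 2n+1 cycles of k / (m - 1) slots, and a request of n+1 edges with two slots
-- each has size m.
cycles-bound : ∀ m k → Parameters m k → OptRatioAtLeast k (OneOutOf k m) (bound m k)
cycles-bound m k (n , u , refl , refl) rewrite bound≡ n (suc (2 * suc u)) = subst₂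
  (λ k m → OptRatioAtLeast k (OneOutOf k m) (ℕ→ℚ (midBinom n * j ^ suc n))) (*-comm (suc (2 * n)) j) (*-comm (suc n) 2)
  (groups-bound (cycle (u + (suc u + 0)) (odd?-2* (suc u))) n)
  where
  j = suc (2 * suc u)

-- Growth of the bound of part (ii)

module _ (n j : ℕ) where

  private
    c m r k b g : ℕ
    c = midBinom n
    m = 2 * suc n
    r = suc (2 * n)
    k = j * r
    g = j ^ suc n
    b = c * g

  m≡1+r : m ≡ suc r
  m≡1+r = cong suc (2*[1+n]∸1≡1+2n n)

  r≤m : r ≤ m
  r≤m = ≤-trans (n≤1+n r) (≤-reflexive (sym m≡1+r))

  x^m : ∀ x → x ^ m ≡ x ^ suc n * x ^ suc n
  x^m x = trans (^-distribˡ-+-* x (suc n) (suc n + 0)) (cong (λ e → x ^ suc n * x ^ e) (+-identityʳ (suc n)))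

  4^m : 4 ^ m ≡ 16 * 16 ^ n
  4^m = sym (^-*-assoc 4 2 (suc n))

  k^m : k ^ m ≡ g * g * r ^ m
  k^m = trans (^-distribʳ-* j r m) (cong (_* r ^ m) (x^m j))

  [4k]^m : (4 * k) ^ m ≡ 16 * 16 ^ n * (g * g * r ^ m)
  [4k]^m = trans (^-distribʳ-* 4 k m) (cong₂ _*_ 4^m k^m)

  m^m≤4*r^m : m ^ m ≤ 4 * r ^ m
  m^m≤4*r^m = subst (λ m → m ^ m ≤ 4 * r ^ m) (sym m≡1+r) ([1+m]^[1+m]≤4*m^[1+m] r)

  16*16^n≤8*c²*m : 16 * 16 ^ n ≤ 8 * (c * c * m)
  16*16^n≤8*c²*m = ≤-trans (*-monoʳ-≤ 16 (midBinom-lower n)) (≤-reflexive (regroup (c * c) n))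
    where
    regroup : ∀ x n → 16 * (x * suc n) ≡ 8 * (x * (2 * suc n))
    regroup = solve-∀

  -- The squared bound is multiplied through by `m ^ m * m`. As (4k)^m = 16^(n+1) g² r^m and b = c
  -- g, it remains to compare 16^(n+1) with c² m, and r^m with m^m.
  lower-ℕ : (4 * k) ^ m ≤ 8 * (b * b * (m ^ m * m))
  lower-ℕ = begin
    (4 * k) ^ m                          ≡⟨ [4k]^m ⟩
    16 * 16 ^ n * (g * g * r ^ m)        ≤⟨ *-mono-≤ 16*16^n≤8*c²*m (*-monoʳ-≤ (g * g) (^-monoˡ-≤ m r≤m)) ⟩
    8 * (c * c * m) * (g * g * m ^ m)    ≡⟨ regroup c m g (m ^ m) ⟩
    8 * (b * b * (m ^ m * m))            ∎
    where
    open ≤-Reasoning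
    regroup : ∀ c m g x → 8 * (c * c * m) * (g * g * x) ≡ 8 * (c * g * (c * g) * (x * m))
    regroup = solve-∀

  -- The same comparison reversed. Replacing m^m by r^m costs a factor 4, and with the 4 of
  -- `midBinom-upper` this makes up exactly the 16, so the constant is 1.
  upper-ℕ : b * b * (m ^ m * m) ≤ (4 * k) ^ m
  upper-ℕ = begin
    b * b * (m ^ m * m)                     ≡⟨ regroup c m g (m ^ m) ⟩
    c * c * m * (g * g * m ^ m)             ≤⟨ *-mono-≤ (*-monoʳ-≤ (c * c) m≤2n+3) (*-monoʳ-≤ (g * g) m^m≤4*r^m) ⟩
    c * c * (2 * n + 3) * (g * g * (4 * r ^ m)) ≤⟨ *-monoˡ-≤ (g * g * (4 * r ^ m)) (midBinom-upper n) ⟩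
    4 * 16 ^ n * (g * g * (4 * r ^ m))      ≡⟨ regroup′ (16 ^ n) (g * g) (r ^ m) ⟩
    16 * 16 ^ n * (g * g * r ^ m)           ≡⟨ [4k]^m ⟨
    (4 * k) ^ m                             ∎
    where
    open ≤-Reasoning
    m≤2n+3 : m ≤ 2 * n + 3
    m≤2n+3 = ≤-trans (n≤1+n m) (≤-reflexive (arith n))
      where
      arith : ∀ n → suc (2 * suc n) ≡ 2 * n + 3
      arith = solve-∀
    regroup : ∀ c m g x → c * g * (c * g) * (x * m) ≡ c * c * m * (g * g * x)
    regroup = solve-∀
    regroup′ : ∀ x y z → 4 * x * (y * (4 * z)) ≡ 16 * x * (y * z)
    regroup′ = solve-∀

  -- The chain is C(k, m) m! ≤ k^m = g² r^m ≤ g² m^m, followed by m^(m+1) ≤ 4^m m! and 4^m ≤ 8 c² m.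
  -- The extra factor m on both sides supplies the exponent m+1.
  kCm≤8*b² : k C m ≤ 8 * (b * b)
  kCm≤8*b² = *-cancelʳ-≤ (k C m) (8 * (b * b)) (m ! * m) {{m*n≢0 (m !) m {{m !≢0}}}} (begin
    (k C m) * (m ! * m)                  ≡⟨ *-assoc (k C m) (m !) m ⟨
    (k C m) * m ! * m                    ≤⟨ *-monoˡ-≤ m (nCk*k!≤n^k k m) ⟩
    k ^ m * m                            ≡⟨ cong (_* m) k^m ⟩
    g * g * r ^ m * m                    ≤⟨ *-monoˡ-≤ m (*-monoʳ-≤ (g * g) (^-monoˡ-≤ m r≤m)) ⟩
    g * g * m ^ m * m                    ≡⟨ regroup (g * g) (m ^ m) m ⟩
    g * g * (m * m ^ m)                  ≤⟨ *-monoʳ-≤ (g * g) (m^[1+m]≤4^m*m! m) ⟩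
    g * g * (4 ^ m * m !)                ≤⟨ *-monoʳ-≤ (g * g) (*-monoˡ-≤ (m !) (≤-trans (≤-reflexive 4^m) 16*16^n≤8*c²*m)) ⟩
    g * g * (8 * (c * c * m) * m !)      ≡⟨ regroup′ g c m (m !) ⟩
    8 * (b * b) * (m ! * m)              ∎)
    where
    open ≤-Reasoning
    regroup : ∀ x y m → x * y * m ≡ x * (m * y)
    regroup = solve-∀
    regroup′ : ∀ g c m f → g * g * (8 * (c * c * m) * f) ≡ 8 * (c * g * (c * g)) * (f * m)
    regroup′ = solve-∀

  scale : ∀ d → (d ℚ.* ((4 * k) ÷ℕ m) ^ℚ m ℚ.* (1 ÷ℕ m)) ℚ.* ℕ→ℚ (m ^ m * m) ≡ d ℚ.* ℕ→ℚ ((4 * k) ^ m)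
  scale d = begin
    (d ℚ.* x ^ℚ m ℚ.* y) ℚ.* ℕ→ℚ (m ^ m * m)
      ≡⟨ cong ((d ℚ.* x ^ℚ m ℚ.* y) ℚ.*_) (trans (ℕ→ℚ-* (m ^ m) m) (cong (ℚ._* ℕ→ℚ m) (ℕ→ℚ-^ m m))) ⟩
    (d ℚ.* x ^ℚ m ℚ.* y) ℚ.* (ℕ→ℚ m ^ℚ m ℚ.* ℕ→ℚ m)
      ≡⟨ solve 5 (λ d p y q z → d :* p :* y :* (q :* z) := d :* (p :* q) :* (y :* z)) refl d (x ^ℚ m) y (ℕ→ℚ m ^ℚ m) (ℕ→ℚ m) ⟩
    d ℚ.* (x ^ℚ m ℚ.* ℕ→ℚ m ^ℚ m) ℚ.* (y ℚ.* ℕ→ℚ m)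
      ≡⟨ cong₂ (λ u v → d ℚ.* u ℚ.* v) (sym (^ℚ-distribʳ-* x (ℕ→ℚ m) m)) (÷ℕ-*-cancel 1 m) ⟩
    d ℚ.* ((x ℚ.* ℕ→ℚ m) ^ℚ m) ℚ.* 1ℚ
      ≡⟨ ℚₚ.*-identityʳ _ ⟩
    d ℚ.* ((x ℚ.* ℕ→ℚ m) ^ℚ m)
      ≡⟨ cong (d ℚ.*_) (trans (cong (_^ℚ m) (÷ℕ-*-cancel (4 * k) m)) (sym (ℕ→ℚ-^ (4 * k) m))) ⟩
    d ℚ.* ℕ→ℚ ((4 * k) ^ m) ∎
    where
    open ≡-Reasoning
    open +-*-Solver
    x = (4 * k) ÷ℕ m
    y = 1 ÷ℕ m

  private instance
    scale-pos : ℚ.Positive (ℕ→ℚ (m ^ m * m))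
    scale-pos = ℕ→ℚ-pos (m ^ m * m) {{m*n≢0 (m ^ m) m {{m^n≢0 m m}}}}

  bound²≡ : bound m k ℚ.* bound m k ≡ ℕ→ℚ (b * b)
  bound²≡ = trans (cong₂ ℚ._*_ (bound≡ n j) (bound≡ n j)) (sym (ℕ→ℚ-* b b))

  bound²-lower : eighth ℚ.* ((4 * k) ÷ℕ m) ^ℚ m ℚ.* (1 ÷ℕ m) ℚ.≤ bound m k ℚ.* bound m k
  bound²-lower = ℚₚ.*-cancelʳ-≤-pos (ℕ→ℚ (m ^ m * m)) (subst₂ ℚ._≤_
    (sym (scale eighth))
    (trans (ℕ→ℚ-* (b * b) (m ^ m * m)) (cong (ℚ._* ℕ→ℚ (m ^ m * m)) (sym bound²≡)))
    (eighth-≤ ((4 * k) ^ m) (b * b * (m ^ m * m)) lower-ℕ))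

  bound²-upper : bound m k ℚ.* bound m k ℚ.≤ 1ℚ ℚ.* ((4 * k) ÷ℕ m) ^ℚ m ℚ.* (1 ÷ℕ m)
  bound²-upper = ℚₚ.*-cancelʳ-≤-pos (ℕ→ℚ (m ^ m * m)) (subst₂ ℚ._≤_
    (trans (ℕ→ℚ-* (b * b) (m ^ m * m)) (cong (ℚ._* ℕ→ℚ (m ^ m * m)) (sym bound²≡)))
    (sym (trans (scale 1ℚ) (ℚₚ.*-identityˡ _)))
    (ℕ→ℚ-mono-≤ upper-ℕ))

  bound²-family : eighth ℚ.* ℕ→ℚ (k C m) ℚ.≤ bound m k ℚ.* bound m k
  bound²-family = subst (eighth ℚ.* ℕ→ℚ (k C m) ℚ.≤_) (sym bound²≡) (eighth-≤ (k C m) (b * b) kCm≤8*b²)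

theorem2 : (∀ (k : ℕ) → Odd k →
    OptRatioAtLeast k (OneOutOf k ((k ℕ.+ 1) / 2)) (ℕ→ℚ (k C ((k ℕ.+ 1) / 2))))
    ×
    (∃[ d ] (0ℚ ℚ.< d × ∃[ k₀ ] ∀ (k : ℕ) → k ≥ k₀ →
    ∃[ L ] (0ℚ ℚ.≤ L
    × d ℚ.* ℕ→ℚ (2 ℕ.^ k) ℚ.* ℕ→ℚ (2 ℕ.^ k) ℚ.≤ L ℚ.* L ℚ.* ℕ→ℚ k
    × OptRatioAtLeast k (OneOutOf k ((k ℕ.+ 1) / 2)) L)))
    ×
    (∀ (m k : ℕ) → Even m → 2 ≤ m → m < k → (∃[ j ] (Odd j × k ≡ j ℕ.* (m ∸ 1))) →
    OptRatioAtLeast k (OneOutOf k m)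
    (ℕ→ℚ ((m ∸ 1) C (m / 2)) ℚ.* ((k ÷ℕ (m ∸ 1)) ^ℚ (m / 2))))
    ×
    (∃[ d₁ ] ∃[ d₂ ] (0ℚ ℚ.< d₁ × 0ℚ ℚ.< d₂ ×
    ∀ (m k : ℕ) → Even m → 2 ≤ m → m < k → (∃[ j ] (Odd j × k ≡ j ℕ.* (m ∸ 1))) →
    (d₁ ℚ.* ((4 ℕ.* k) ÷ℕ m) ^ℚ m ℚ.* (1 ÷ℕ m)
    ℚ.≤ (ℕ→ℚ ((m ∸ 1) C (m / 2)) ℚ.* ((k ÷ℕ (m ∸ 1)) ^ℚ (m / 2)))
    ℚ.* (ℕ→ℚ ((m ∸ 1) C (m / 2)) ℚ.* ((k ÷ℕ (m ∸ 1)) ^ℚ (m / 2))))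
    × ((ℕ→ℚ ((m ∸ 1) C (m / 2)) ℚ.* ((k ÷ℕ (m ∸ 1)) ^ℚ (m / 2)))
    ℚ.* (ℕ→ℚ ((m ∸ 1) C (m / 2)) ℚ.* ((k ÷ℕ (m ∸ 1)) ^ℚ (m / 2)))
    ℚ.≤ d₂ ℚ.* ((4 ℕ.* k) ÷ℕ m) ^ℚ m ℚ.* (1 ÷ℕ m))))
    ×
    (∃[ d ] (0ℚ ℚ.< d ×
    ∀ (m k : ℕ) → Even m → 2 ≤ m → m < k → (∃[ j ] (Odd j × k ≡ j ℕ.* (m ∸ 1))) →
    d ℚ.* ℕ→ℚ (k C m)
    ℚ.≤ (ℕ→ℚ ((m ∸ 1) C (m / 2)) ℚ.* ((k ÷ℕ (m ∸ 1)) ^ℚ (m / 2)))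
    ℚ.* (ℕ→ℚ ((m ∸ 1) C (m / 2)) ℚ.* ((k ÷ℕ (m ∸ 1)) ^ℚ (m / 2)))))
theorem2 =
    odd-case
  -- The threshold is 1 because at k = 0 the right side of the estimate vanishes.
  , (eighth , 0<eighth , 1 , λ k 1≤k → middle-asymptotics k {{ℕ.>-nonZero 1≤k}})
  , (λ m k even 2≤m m<k multiple → cycles-bound m k (parameters m k even 2≤m m<k multiple))
  , (eighth , 1ℚ , 0<eighth , ℚₚ.positive⁻¹ 1ℚ , λ m k even 2≤m m<k multiple →
      theta m k (parameters m k even 2≤m m<k multiple))
  , (eighth , 0<eighth , λ m k even 2≤m m<k multiple → family m k (parameters m k even 2≤m m<k multiple))
  where
  odd-case : ∀ k → Odd k → OptRatioAtLeast k (OneOutOf k ((k + 1) / 2)) (ℕ→ℚ (k C ((k + 1) / 2)))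
  odd-case k (n , refl) = subst
    (λ m → OptRatioAtLeast (suc (2 * n)) (OneOutOf (suc (2 * n)) m) (ℕ→ℚ (suc (2 * n) C m)))
    (sym ([1+2n+1]/2≡1+n n)) (odd-bound n)
  theta : ∀ m k → Parameters m k →
    (eighth ℚ.* ((4 * k) ÷ℕ m) ^ℚ m ℚ.* (1 ÷ℕ m) ℚ.≤ bound m k ℚ.* bound m k)
    × (bound m k ℚ.* bound m k ℚ.≤ 1ℚ ℚ.* ((4 * k) ÷ℕ m) ^ℚ m ℚ.* (1 ÷ℕ m))
  theta m k (n , u , refl , refl) = bound²-lower n (suc (2 * suc u)) , bound²-upper n (suc (2 * suc u))
  family : ∀ m k → Parameters m k → eighth ℚ.* ℕ→ℚ (k C m) ℚ.≤ bound m k ℚ.* bound m k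
  family m k (n , u , refl , refl) = bound²-family n (suc (2 * suc u))
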